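{- Let $a,b\in\mathbb{Z}$ with $\gcd(a,b)=1$. If $a^2+ab-b^2\equiv 0\pmod 5$, then $M_{(a,b)}=M_L=\{2,4,6,7,14\}\cup\{3^j:j\ge1\}$. Otherwise $M_{(a,b)}=M_F$, where $M_F=\{5^k,\,2\cdot5^k,\,4\cdot5^k,\,3^j\cdot5^k,\,6\cdot5^k,\,7\cdot5^k,\,14\cdot5^k : k\ge0,\ j\ge1\}\setminus\{1\}$.
   Context: For integers $a,b$ with $\gcd(a,b)=1$, the Gibonacci sequence $\{G_n(a,b)\}_{n\ge1}$ is defined by $G_1=a$, $G_2=b$, $G_{n+1}=G_{n-1}+G_n$. A sequence is complete mod $m$ if every residue class modulo $m$ contains some term of the sequence. $M_{(a,b)}$ denotes the set of integers $m\ge2$ such that $\{G_n(a,b)\}$ is complete mod $m$; $M_F=M_{(1,1)}$ (Fibonacci) and $M_L=M_{(1,3)}$ (Lucas). -}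

module Defs where

open import Data.Integer.Base using (ℤ; +_; _+_; _-_)
open import Data.Integer.Divisibility.Signed using (_∣_)
open import Data.List.Base using (_∷_; [])
open import Data.List.Membership.Propositional using () renaming (_∈_ to _∈ˡ_)
open import Data.Nat.Base as ℕ using (ℕ; zero; suc; _≤_; _^_)
open import Data.Product.Base using (_×_; ∃-syntax)
open import Level using (0ℓ)
open import Relation.Binary.PropositionalEquality.Core using (_≡_)
open import Relation.Unary using (Pred; _∪_; _∖_; ｛_｝)

infix 4 _≡_[mod_]

_≡_[mod_] : ℤ → ℤ → ℕ → Set
x ≡ y [mod m ] = + m ∣ x - y

-- Indexing is shifted by one: G a b n is the term Gₙ₊₁(a,b), so that the
-- sequence (Gₙ)ₙ≥₁ is exactly the range of G a b over all of ℕ.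
G : ℤ → ℤ → ℕ → ℤ
G a b zero          = a
G a b (suc zero)    = b
G a b (suc (suc n)) = G a b n + G a b (suc n)

CompleteMod : (ℕ → ℤ) → ℕ → Set
CompleteMod s m = ∀ (r : ℤ) → ∃[ n ] s n ≡ r [mod m ]

M : ℤ → ℤ → Pred ℕ 0ℓ
M a b m = 2 ≤ m × CompleteMod (G a b) m

M-F : Pred ℕ 0ℓ
M-F = M (+ 1) (+ 1)

M-L : Pred ℕ 0ℓ
M-L = M (+ 1) (+ 3)

-- {2,4,6,7,14} ∪ {3ʲ : j ≥ 1}
LucasModuli : Pred ℕ 0ℓ
LucasModuli = (_∈ˡ 2 ∷ 4 ∷ 6 ∷ 7 ∷ 14 ∷ []) ∪ (λ m → ∃[ j ] 1 ≤ j × m ≡ 3 ^ j)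

-- {5ᵏ, 2·5ᵏ, 4·5ᵏ, 3ʲ·5ᵏ, 6·5ᵏ, 7·5ᵏ, 14·5ᵏ : k ≥ 0, j ≥ 1} ∖ {1}
FibonacciModuli : Pred ℕ 0ℓ
FibonacciModuli = family ∖ ｛ 1 ｝
  where
  family : Pred ℕ 0ℓ
  family m = ∃[ k ] ∃[ j ] 1 ≤ j ×
    m ∈ˡ 5 ^ k ∷ 2 ℕ.* 5 ^ k ∷ 4 ℕ.* 5 ^ k ∷ 3 ^ j ℕ.* 5 ^ k
       ∷ 6 ℕ.* 5 ^ k ∷ 7 ℕ.* 5 ^ k ∷ 14 ℕ.* 5 ^ k ∷ []

{-# OPTIONS --safe #-}

-- Zeros.  If Gₙ ≡ 0 (mod m) then Gₙ₊ₖ ≡ Gₙ₊₁ Fₖ with Gₙ₊₁ a unit modulo m, so (Gₙ) is complete modulo m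
-- exactly when (Fₙ) is and (Gₙ) has a zero modulo m.
--
-- Complete moduli.  Suppose the shift S satisfies S^π ≡ 1 + m z with z = y + x S, and q ∣ m (q = 3, 5).
-- Then S^(kπ) ≡ 1 + k m z (mod q m), so a residue hit at an n with (z G)ₙ a unit modulo q lifts from m
-- to q m.  Newton's formula gives S^(qπ) ≡ 1 + q m z to the next order, so the lifting can be iterated,
-- and finitely many moduli remain to be computed.  A zero modulo 5 exists when a² + ab − b² ≢ 0 (mod 5),
-- and none does otherwise, since this form is invariant up to sign along the sequence.
--
-- Incomplete moduli.  Let p be a prime other than 2, 3, 5, 7.  From S² = 1 + S and the binomial theorem,
-- S^(2p) ≡ 1 + S^p (mod p), which forces (Fₚ, Fₚ₊₁) ≡ (1, 1) or (−1, 0).  In the first case p − 1 is a period,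
-- too short to be complete.  In the second case put p + 1 = 2h; then Fₙ² takes no other values than at
-- n = 0, 2, 3, …, h.  If F were complete, these h values would be the squares of 0, …, h − 1, so that
-- Fₕ Fₕ₊₁ − 1 = F₂² + … + Fₕ² ≡ 0.  Together with F₂ₕ ≡ 0 and F₂ₕ₊₁ ≡ −1 this gives p ∣ 7.
module Submission where

open import Defs
import Algebra.Properties.CommutativeMonoid.Sum as Sum
open import Data.Empty using (⊥; ⊥-elim)
open import Data.Fin.Base using (Fin; zero; suc; toℕ; fromℕ<; combine; punchOut)
open import Data.Fin.Permutation using (Permutation; permutation)
import Data.Fin.Properties as Fin
open import Data.Integer.Base using (ℤ; +_; -[1+_]; -_; _+_; _-_; _*_; _⊖_; ∣_∣)
open import Data.Integer.DivMod using (_%ℕ_; _/ℕ_; n%ℕd<d; a≡a%ℕn+[a/ℕn]*n)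
open import Data.Integer.Divisibility.Signed using (_∣_; divides; ∣-trans; ∣m∣n⇒∣m+n; ∣n⇒∣m*n; ∣m⇒∣-m; ∣ᵤ⇒∣; ∣⇒∣ᵤ; *-monoʳ-∣)
open import Data.Integer.GCD using (gcd)
import Data.Integer.Properties as ℤ
open import Data.Integer.Tactic.RingSolver using (solve-∀)
open import Data.List.Base using ([]; _∷_)
open import Data.List.Membership.Propositional using (_∈_)
open import Data.List.Relation.Unary.All as All using (All; []; _∷_)
open import Data.List.Relation.Unary.Any using (here; there)
open import Data.Nat.Base as ℕ using (ℕ; zero; suc; _%_; _/_; _≤_; _<_; _^_; s≤s; z≤n)
open import Data.Nat.Combinatorics using (_C_; nCk+nC[k+1]≡[n+1]C[k+1]; nCn≡1)
open import Data.Nat.Coprimality using (Coprime; coprime?; coprime-divisor)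
import Data.Nat.Divisibility as ℕ
import Data.Nat.DivMod as ℕ
open import Data.Nat.GCD using (GCD; gcd-GCD; module Bézout)
open import Data.Nat.ListAction using (product)
open import Data.Nat.ListAction.Properties using (∈⇒∣product)
open import Data.Nat.Primality using (Prime; euclidsLemma; prime⇒nonZero; prime⇒irreducible; prime?; prime[2]; ¬prime[1])
open import Data.Nat.Primality.Factorisation using (PrimeFactorisation; factorise)
import Data.Nat.Properties as ℕ
import Data.Nat.Tactic.RingSolver as ℕRing
open import Data.Product.Base using (_×_; _,_; ∃-syntax; proj₁; proj₂)
open import Data.Sum.Base using (_⊎_; inj₁; inj₂; [_,_]′)
open import Function.Base using (_∘_)
open import Function.Definitions using (Injective)
open import Function.Strict using (force; force-≡)
open import Level using (0ℓ)
open import Relation.Binary.Bundles using (Setoid)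
open import Relation.Binary.PropositionalEquality
import Relation.Binary.Reasoning.Setoid as SetoidReasoning
open import Relation.Nullary using (¬_; Dec; yes; no; ¬?)
open import Relation.Nullary.Decidable using (True; toWitness; from-yes; decidable-stable; _×-dec_; _⊎-dec_)
open import Relation.Unary using (_≐_)
open import Relation.Unary.Properties using (≐-sym; ≐-trans)

open Sum ℤ.+-0-commutativeMonoid using (sum; sum-cong-≗; ∑-distrib-+; sum-permute; sum-replicate-zero)

private
  variable
    l m q ρ : ℕ
    x y z w x′ y′ : ℤ
    s : ℕ → ℤ

-- Congruences

infix 4 _≋_[_]

-- A record rather than _≡_[mod_] itself, which unfolds and so prevents inference of x, y and m.
record _≋_[_] (x y : ℤ) (m : ℕ) : Set where
  constructor mod
  field ∣-diff : + m ∣ x - y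

open _≋_[_]

mod-reflexive : x ≡ y → x ≋ y [ m ]
mod-reflexive {x} refl = mod (divides (+ 0) (ℤ.+-inverseʳ x))

mod-refl : x ≋ x [ m ]
mod-refl = mod-reflexive refl

mod-sym : x ≋ y [ m ] → y ≋ x [ m ]
mod-sym {x} {y} (mod d) = mod (subst (_ ∣_) (lemma x y) (∣m⇒∣-m d))
  where
  lemma : ∀ x y → - (x - y) ≡ y - x
  lemma = solve-∀

mod-trans : x ≋ y [ m ] → y ≋ z [ m ] → x ≋ z [ m ]
mod-trans {x} {y} {m} {z} (mod d) (mod e) = mod (subst (+ m ∣_) (lemma x y z) (∣m∣n⇒∣m+n d e))
  where
  lemma : ∀ x y z → (x - y) + (y - z) ≡ x - z
  lemma = solve-∀

modSetoid : ℕ → Setoid 0ℓ 0ℓ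
modSetoid m = record
  { Carrier = ℤ ; _≈_ = _≋_[ m ]
  ; isEquivalence = record { refl = mod-refl ; sym = mod-sym ; trans = mod-trans } }

module mod-Reasoning m = SetoidReasoning (modSetoid m)

mod-+ : x ≋ y [ m ] → z ≋ w [ m ] → x + z ≋ y + w [ m ]
mod-+ {x} {y} {m} {z} {w} (mod d) (mod e) = mod (subst (+ m ∣_) (lemma x y z w) (∣m∣n⇒∣m+n d e))
  where
  lemma : ∀ x y z w → (x - y) + (z - w) ≡ (x + z) - (y + w)
  lemma = solve-∀

mod-* : x ≋ y [ m ] → z ≋ w [ m ] → x * z ≋ y * w [ m ]
mod-* {x} {y} {m} {z} {w} (mod d) (mod e) =
  mod (subst (+ m ∣_) (lemma x y z w) (∣m∣n⇒∣m+n (∣n⇒∣m*n z d) (∣n⇒∣m*n y e)))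
  where
  lemma : ∀ x y z w → z * (x - y) + y * (z - w) ≡ x * z - y * w
  lemma = solve-∀

mod-neg : x ≋ y [ m ] → - x ≋ - y [ m ]
mod-neg {x} {y} {m} (mod d) = mod (subst (+ m ∣_) (ℤ.neg-distrib-+ x (- y)) (∣m⇒∣-m d))

mod-- : x ≋ y [ m ] → z ≋ w [ m ] → x - z ≋ y - w [ m ]
mod-- d e = mod-+ d (mod-neg e)

mod-+ˡ : ∀ z → x ≋ y [ m ] → z + x ≋ z + y [ m ]
mod-+ˡ z = mod-+ (mod-refl {z})

mod-+ʳ : ∀ z → x ≋ y [ m ] → x + z ≋ y + z [ m ]
mod-+ʳ z e = mod-+ e (mod-refl {z})

mod-*ˡ : ∀ z → x ≋ y [ m ] → z * x ≋ z * y [ m ]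
mod-*ˡ z = mod-* (mod-refl {z})

mod-*ʳ : ∀ z → x ≋ y [ m ] → x * z ≋ y * z [ m ]
mod-*ʳ z e = mod-* e (mod-refl {z})

mod-∣ : l ℕ.∣ m → x ≋ y [ m ] → x ≋ y [ l ]
mod-∣ l∣m (mod d) = mod (∣-trans (∣ᵤ⇒∣ l∣m) d)

≋0⇒∣ : x ≋ + 0 [ m ] → + m ∣ x
≋0⇒∣ {x} (mod d) = subst (_ ∣_) (ℤ.+-identityʳ x) d

∣⇒≋0 : + m ∣ x → x ≋ + 0 [ m ]
∣⇒≋0 {x = x} d = mod (subst (_ ∣_) (sym (ℤ.+-identityʳ x)) d)

mod-%ℕ : ∀ x m .{{_ : ℕ.NonZero m}} → x ≋ + (x %ℕ m) [ m ]
mod-%ℕ x m = mod (divides (x /ℕ m) (begin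
  x - + (x %ℕ m)                              ≡⟨ cong (_- + (x %ℕ m)) (a≡a%ℕn+[a/ℕn]*n x m) ⟩
  (+ (x %ℕ m) + (x /ℕ m) * + m) - + (x %ℕ m)  ≡⟨ lemma (+ (x %ℕ m)) ((x /ℕ m) * + m) ⟩
  (x /ℕ m) * + m                              ∎))
  where
  open ≡-Reasoning
  lemma : ∀ r q → (r + q) - r ≡ q
  lemma = solve-∀

-- Gibonacci sequences

record IsGib (s : ℕ → ℤ) : Set where
  constructor gib
  field recurrence : ∀ n → s (2 ℕ.+ n) ≡ s n + s (1 ℕ.+ n)

open IsGib

-- Starts at 0, one place before `G (+ 1) (+ 1)`, so that index 0 is a zero and `F k` is the
-- coefficient of S in S^k for the shift S.
F : ℕ → ℤ
F = G (+ 0) (+ 1)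

G-isGib : ∀ a b → IsGib (G a b)
G-isGib a b = gib λ _ → refl

gib-unique : ∀ {s t} → IsGib s → IsGib t → s 0 ≡ t 0 → s 1 ≡ t 1 → ∀ n → s n ≡ t n
gib-unique {s} {t} (gib gs) (gib gt) e₀ e₁ n = proj₁ (go n)
  where
  go : ∀ n → s n ≡ t n × s (suc n) ≡ t (suc n)
  go zero    = e₀ , e₁
  go (suc n) with go n
  ... | p , q = q , trans (gs n) (trans (cong₂ _+_ p q) (sym (gt n)))

-- This is S^k = F_k S + F_{k-1}, with `F (suc k) - F k` for F_{k-1} to avoid a predecessor. Both
-- sides are Gibonacci in `k` and agree at 0 and 1.
gib-+ : ∀ {s} → IsGib s → ∀ k n →
        s (k ℕ.+ n) ≡ F k * s (suc n) + (F (suc k) - F k) * s n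
gib-+ {s} (gib gs) k n = gib-unique {λ k → s (k ℕ.+ n)}
  {λ k → F k * s (suc n) + (F (suc k) - F k) * s n} (gib λ k → gs (k ℕ.+ n))
  (gib λ k → step (F k) (F (suc k)) (s n) (s (suc n)))
  (at₀ (s n) (s (suc n))) (at₁ (s n) (s (suc n))) k
  where
  step : ∀ f g a b → (f + g) * b + ((g + (f + g)) - (f + g)) * a ≡
                     (f * b + (g - f) * a) + (g * b + ((f + g) - g) * a)
  step = solve-∀
  at₀ : ∀ a b → a ≡ + 0 * b + (+ 1 - + 0) * a
  at₀ = solve-∀
  at₁ : ∀ a b → b ≡ + 1 * b + ((+ 0 + + 1) - + 1) * a
  at₁ = solve-∀

F-2n : ∀ n → F (n ℕ.+ n) ≡ F n * (+ 2 * F (suc n) - F n)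
F-2n n = trans (gib-+ (G-isGib _ _) n n) (lemma (F n) (F (suc n)))
  where
  lemma : ∀ a b → a * b + (b - a) * a ≡ a * (+ 2 * b - a)
  lemma = solve-∀

F-2n+1 : ∀ n → F (suc (n ℕ.+ n)) ≡ F n * F n + F (suc n) * F (suc n)
F-2n+1 n = trans (gib-+ (G-isGib _ _) (suc n) n) (lemma (F n) (F (suc n)))
  where
  lemma : ∀ a b → b * b + ((a + b) - b) * a ≡ a * a + b * b
  lemma = solve-∀

-- The norm of a + bφ in ℤ[φ], φ the golden ratio. One step of the sequence multiplies by φ, whose
-- norm is -1; hence the sign change in `Δ-step`.
Δ : ℤ → ℤ → ℤ
Δ a b = a * a + a * b - b * b

Δ-step : ∀ {s} → IsGib s → ∀ n → Δ (s (suc n)) (s (2 ℕ.+ n)) ≡ - Δ (s n) (s (suc n))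
Δ-step {s} (gib gs) n rewrite gs n = lemma (s n) (s (suc n))
  where
  lemma : ∀ a b → b * b + b * (a + b) - (a + b) * (a + b) ≡ - (a * a + a * b - b * b)
  lemma = solve-∀

-- Coprimality in Bézout form: it reduces modulo `m` directly, and its coefficients can be carried
-- along the sequence.
Primitive : ℤ → ℤ → Set
Primitive a b = ∃[ u ] ∃[ v ] u * a + v * b ≡ + 1

primitive-G : ∀ {s} → IsGib s → Primitive (s 0) (s 1) → ∀ n → Primitive (s n) (s (suc n))
primitive-G gs e zero = e
primitive-G {s} gs e (suc n) with primitive-G gs e n
... | u , v , eq = v - u , u , (begin
  (v - u) * s (suc n) + u * s (2 ℕ.+ n)         ≡⟨ cong (λ t → (v - u) * s (suc n) + u * t) (recurrence gs n) ⟩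
  (v - u) * s (suc n) + u * (s n + s (suc n))   ≡⟨ lemma u v (s n) (s (suc n)) ⟩
  u * s n + v * s (suc n)                       ≡⟨ eq ⟩
  + 1                                           ∎)
  where
  open ≡-Reasoning
  lemma : ∀ u v a b → (v - u) * b + u * (a + b) ≡ u * a + v * b
  lemma = solve-∀

-- Zeros and periods

Complete : (ℕ → ℤ) → ℕ → Set
Complete s m = ∀ r → ∃[ n ] s n ≋ r [ m ]

zero-shift : IsGib s → ∀ n → s n ≋ + 0 [ m ] → ∀ k → s (k ℕ.+ n) ≋ F k * s (suc n) [ m ]
zero-shift {s} {m} gs n e k = begin
  s (k ℕ.+ n)                                   ≡⟨ gib-+ gs k n ⟩
  F k * s (suc n) + (F (suc k) - F k) * s n     ≈⟨ mod-+ˡ (F k * s (suc n)) (mod-*ˡ (F (suc k) - F k) e) ⟩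
  F k * s (suc n) + (F (suc k) - F k) * + 0     ≡⟨ lemma (F k * s (suc n)) (F (suc k) - F k) ⟩
  F k * s (suc n)                               ∎
  where
  open mod-Reasoning m
  lemma : ∀ a b → a + b * + 0 ≡ a
  lemma = solve-∀

-- Modulo `m` the Bézout relation for two consecutive terms loses its first summand, so the second
-- coefficient inverts `s (suc n)`.
zero-inverse : IsGib s → Primitive (s 0) (s 1) → ∀ n → s n ≋ + 0 [ m ] →
               ∃[ v ] v * s (suc n) ≋ + 1 [ m ]
zero-inverse {s} {m} gs prim n e with primitive-G gs prim n
... | u , v , eq = v , (begin
  v * s (suc n)                 ≡⟨ lemma u (v * s (suc n)) ⟩
  u * + 0 + v * s (suc n)       ≈⟨ mod-+ʳ (v * s (suc n)) (mod-*ˡ u (mod-sym e)) ⟩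
  u * s n + v * s (suc n)       ≡⟨ eq ⟩
  + 1                           ∎)
  where
  open mod-Reasoning m
  lemma : ∀ u a → a ≡ u * + 0 + a
  lemma = solve-∀

-- Quantified over all Gibonacci sequences, this says S^π ≡ 1. It includes `π` = 0, so positivity is
-- required separately where it matters.
Period : ℕ → ℕ → Set
Period m π = ∀ {s} → IsGib s → ∀ n → s (π ℕ.+ n) ≋ s n [ m ]

F⇒period : ∀ {m π} → F π ≋ + 0 [ m ] → F (suc π) ≋ + 1 [ m ] → Period m π
F⇒period {m} {π} e₀ e₁ {s} gs n = begin
  s (π ℕ.+ n)                                   ≡⟨ gib-+ gs π n ⟩
  F π * s (suc n) + (F (suc π) - F π) * s n     ≈⟨ mod-+ (mod-*ʳ (s (suc n)) e₀) (mod-*ʳ (s n) (mod-- e₁ e₀)) ⟩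
  + 0 * s (suc n) + (+ 1 - + 0) * s n           ≡⟨ lemma (s (suc n)) (s n) ⟩
  s n                                           ∎
  where
  open mod-Reasoning m
  lemma : ∀ a b → + 0 * a + (+ 1 - + 0) * b ≡ b
  lemma = solve-∀

period-* : ∀ {m π} → Period m π → ∀ k → Period m (k ℕ.* π)
period-* per zero gs n = mod-refl
period-* {m} {π} per (suc k) {s} gs n = begin
  s (π ℕ.+ k ℕ.* π ℕ.+ n)       ≡⟨ cong s (ℕ.+-assoc π (k ℕ.* π) n) ⟩
  s (π ℕ.+ (k ℕ.* π ℕ.+ n))     ≈⟨ per gs _ ⟩
  s (k ℕ.* π ℕ.+ n)             ≈⟨ period-* per k gs n ⟩
  s n                           ∎
  where open mod-Reasoning m

%ℕ-injective : ∀ x y m .{{_ : ℕ.NonZero m}} → x %ℕ m ≡ y %ℕ m → x ≋ y [ m ]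
%ℕ-injective x y m e =
  mod-trans (mod-%ℕ x m) (mod-trans (mod-reflexive (cong +_ e)) (mod-sym (mod-%ℕ y m)))

residue : ∀ m .{{_ : ℕ.NonZero m}} → ℤ → Fin m
residue m x = fromℕ< (n%ℕd<d x m)

residue-injective : ∀ m .{{_ : ℕ.NonZero m}} {x y} → residue m x ≡ residue m y → x ≋ y [ m ]
residue-injective m {x} {y} e = %ℕ-injective x y m (begin
  x %ℕ m               ≡⟨ Fin.toℕ-fromℕ< _ ⟨
  toℕ (residue m x)    ≡⟨ cong toℕ e ⟩
  toℕ (residue m y)    ≡⟨ Fin.toℕ-fromℕ< _ ⟩
  y %ℕ m               ∎)
  where open ≡-Reasoning

gib-back : IsGib s → ∀ i d → s i ≋ s (i ℕ.+ d) [ m ] → s (suc i) ≋ s (suc (i ℕ.+ d)) [ m ] →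
           s 0 ≋ s d [ m ] × s 1 ≋ s (suc d) [ m ]
gib-back gs zero d e₀ e₁ = e₀ , e₁
gib-back {s} {m} gs (suc i) d e₀ e₁ = gib-back gs i d (begin
  s i                                           ≡⟨ lemma (s i) (s (suc i)) ⟩
  (s i + s (suc i)) - s (suc i)                 ≡⟨ cong (_- s (suc i)) (recurrence gs i) ⟨
  s (2 ℕ.+ i) - s (suc i)                       ≈⟨ mod-- e₁ e₀ ⟩
  s (2 ℕ.+ i ℕ.+ d) - s (suc i ℕ.+ d)           ≡⟨ cong (_- s (suc i ℕ.+ d)) (recurrence gs (i ℕ.+ d)) ⟩
  (s (i ℕ.+ d) + s (suc i ℕ.+ d)) - s (suc i ℕ.+ d)  ≡⟨ lemma (s (i ℕ.+ d)) (s (suc i ℕ.+ d)) ⟨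
  s (i ℕ.+ d)                                   ∎) e₀
  where
  open mod-Reasoning m
  lemma : ∀ a b → a ≡ (a + b) - b
  lemma = solve-∀

-- Pigeonhole on m² + 1 consecutive pairs of residues. The recurrence runs backwards, so `gib-back`
-- moves the repetition to the start, where it says (F d, F (d + 1)) ≡ (0, 1).
period-exists : ∀ m .{{_ : ℕ.NonZero m}} → ∃[ π ] 1 ℕ.≤ π × Period m π
period-exists m
  with Fin.pigeonhole (ℕ.n<1+n (m ℕ.* m)) (λ i → combine (residue m (F (toℕ i))) (residue m (F (suc (toℕ i)))))
... | i , j , i<j , e = d , ℕ.m<n⇒0<n∸m i<j , F⇒period (mod-sym (proj₁ back)) (mod-sym (proj₂ back))
  where
  d = toℕ j ℕ.∸ toℕ i
  i+d≡j : toℕ i ℕ.+ d ≡ toℕ j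
  i+d≡j = ℕ.m+[n∸m]≡n (ℕ.<⇒≤ i<j)
  same = Fin.combine-injective _ _ _ _ e
  back = gib-back (G-isGib _ _) (toℕ i) d
    (subst (λ k → F (toℕ i) ≋ F k [ m ]) (sym i+d≡j) (residue-injective m (proj₁ same)))
    (subst (λ k → F (suc (toℕ i)) ≋ F (suc k) [ m ]) (sym i+d≡j) (residue-injective m (proj₂ same)))

-- From a zero at `n` on, `s` is F scaled by the unit `s (suc n)`, so F takes the value `r` where
-- `s` takes `r * s (suc n)`.
periodic∧complete⇒F-complete : ∀ {π} → 1 ℕ.≤ π → Period m π → IsGib s → Primitive (s 0) (s 1) →
                               Complete s m → Complete F m
periodic∧complete⇒F-complete {m} {s} {π} 1≤π per gs prim comp r with comp (+ 0)
... | n , e with zero-inverse gs prim n e | comp (r * s (suc n))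
... | v , ve | t , te = k , (begin
  F k                           ≡⟨ lemma₁ (F k) ⟩
  + 1 * F k                     ≈⟨ mod-*ʳ (F k) (mod-sym ve) ⟩
  v * s (suc n) * F k           ≡⟨ lemma₂ v (s (suc n)) (F k) ⟩
  v * (F k * s (suc n))         ≈⟨ mod-*ˡ v (zero-shift gs n e k) ⟨
  v * s (k ℕ.+ n)               ≡⟨ cong (λ i → v * s i) k+n≡ ⟩
  v * s (n ℕ.* π ℕ.+ t)         ≈⟨ mod-*ˡ v (period-* per n gs t) ⟩
  v * s t                       ≈⟨ mod-*ˡ v te ⟩
  v * (r * s (suc n))           ≡⟨ lemma₃ v r (s (suc n)) ⟩
  r * (v * s (suc n))           ≈⟨ mod-*ˡ r ve ⟩
  r * + 1                       ≡⟨ ℤ.*-identityʳ r ⟩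
  r                             ∎)
  where
  open mod-Reasoning m
  -- Adding `n` periods brings the index to at least `n`, since `π` is positive, so the truncated
  -- subtraction is exact.
  k = n ℕ.* π ℕ.+ t ℕ.∸ n
  k+n≡ : k ℕ.+ n ≡ n ℕ.* π ℕ.+ t
  k+n≡ = ℕ.m∸n+n≡m (ℕ.≤-trans (ℕ.m≤m*n n π {{ℕ.>-nonZero 1≤π}}) (ℕ.m≤m+n _ t))
  lemma₁ : ∀ a → a ≡ + 1 * a
  lemma₁ = solve-∀
  lemma₂ : ∀ v a f → v * a * f ≡ v * (f * a)
  lemma₂ = solve-∀
  lemma₃ : ∀ v r a → v * (r * a) ≡ r * (v * a)
  lemma₃ = solve-∀

complete⇒F-complete : ∀ m .{{_ : ℕ.NonZero m}} → IsGib s → Primitive (s 0) (s 1) →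
                      Complete s m → Complete F m
complete⇒F-complete m =
  let π , 1≤π , per = period-exists m in periodic∧complete⇒F-complete 1≤π per

-- Lifting from m to q m

-- A residue hit at n can be lifted to higher moduli when y sₙ + x sₙ₊₁ is a unit modulo ρ.
record Good (s : ℕ → ℤ) (x y : ℤ) (ρ m : ℕ) : Set where
  constructor good
  field hit : ∀ r → ∃[ n ] s n ≋ r [ m ] × ∃[ v ] v * (y * s n + x * s (suc n)) ≋ + 1 [ ρ ]

open Good

good⇒complete : Good s x y ρ m → Complete s m
good⇒complete g r with hit g r
... | n , e , _ = n , e

-- Past a zero, `s` is F times the unit `u`. Looking up `v₀ * r` in F undoes this factor, and the
-- linear form is only multiplied by `u`, so it remains a unit.
F-good⇒good : IsGib s → Primitive (s 0) (s 1) → ∀ n → s n ≋ + 0 [ m ] → ρ ℕ.∣ m →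
              Good F x y ρ m → Good s x y ρ m
F-good⇒good {s} {m} {ρ} {x} {y} gs prim n e ρ∣m g = good go
  where
  inv = zero-inverse gs prim n e
  v₀ = proj₁ inv
  u = s (suc n)
  go : ∀ r → ∃[ n ] s n ≋ r [ m ] × ∃[ v ] v * (y * s n + x * s (suc n)) ≋ + 1 [ ρ ]
  go r with hit g (v₀ * r)
  ... | k , ke , v , ve = k ℕ.+ n , first , v * v₀ , second
    where
    first : s (k ℕ.+ n) ≋ r [ m ]
    first = begin
      s (k ℕ.+ n)         ≈⟨ zero-shift gs n e k ⟩
      F k * u             ≈⟨ mod-*ʳ u ke ⟩
      v₀ * r * u          ≡⟨ lemma v₀ r u ⟩
      r * (v₀ * u)        ≈⟨ mod-*ˡ r (proj₂ inv) ⟩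
      r * + 1             ≡⟨ ℤ.*-identityʳ r ⟩
      r                   ∎
      where
      open mod-Reasoning m
      lemma : ∀ v r u → v * r * u ≡ r * (v * u)
      lemma = solve-∀
    second : v * v₀ * (y * s (k ℕ.+ n) + x * s (suc (k ℕ.+ n))) ≋ + 1 [ ρ ]
    second = begin
      v * v₀ * (y * s (k ℕ.+ n) + x * s (suc (k ℕ.+ n)))  ≈⟨ mod-*ˡ (v * v₀) (mod-+
          (mod-*ˡ y (mod-∣ ρ∣m (zero-shift gs n e k)))
          (mod-*ˡ x (mod-∣ ρ∣m (zero-shift gs n e (suc k))))) ⟩
      v * v₀ * (y * (F k * u) + x * (F (suc k) * u))  ≡⟨ lemma v v₀ u x y (F k) (F (suc k)) ⟩
      v * (y * F k + x * F (suc k)) * (v₀ * u)        ≈⟨ mod-* ve (mod-∣ ρ∣m (proj₂ inv)) ⟩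
      + 1                                             ∎
      where
      open mod-Reasoning ρ
      lemma : ∀ v v₀ u x y f g → v * v₀ * (y * (f * u) + x * (g * u)) ≡ v * (y * f + x * g) * (v₀ * u)
      lemma = solve-∀

-- Writing S for the shift operator: S^π ≡ 1 + m (y + x S) modulo m ρ.
record Shift (x y : ℤ) (ρ m π : ℕ) : Set where
  constructor shift
  field shifted : ∀ {s} → IsGib s → ∀ n →
                  s (π ℕ.+ n) ≋ s n + + m * (y * s n + x * s (suc n)) [ m ℕ.* ρ ]

open Shift

mod-scale : ∀ k → x ≋ y [ m ] → + k * x ≋ + k * y [ k ℕ.* m ]
mod-scale {x} {y} {m} k (mod d) = mod (subst₂ _∣_ (sym (ℤ.pos-* k m)) (lemma (+ k) x y) (*-monoʳ-∣ (+ k) d))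
  where
  lemma : ∀ k x y → k * (x - y) ≡ k * x - k * y
  lemma = solve-∀

self≋0 : ∀ m z → + m * z ≋ + 0 [ m ]
self≋0 m z = ∣⇒≋0 (divides z (ℤ.*-comm (+ m) z))

shift⇒period : ∀ {π} → Shift x y ρ m π → Period m π
shift⇒period {x} {y} {ρ} {m} {π} S {s} gs n = begin
  s (π ℕ.+ n)                                   ≈⟨ mod-∣ (ℕ.m∣m*n ρ) (shifted S gs n) ⟩
  s n + + m * (y * s n + x * s (suc n))         ≈⟨ mod-+ˡ (s n) (self≋0 m (y * s n + x * s (suc n))) ⟩
  s n + + 0                                     ≡⟨ ℤ.+-identityʳ (s n) ⟩
  s n                                           ∎
  where open mod-Reasoning m

form-cong : ∀ x y {a b c d} → a ≋ c [ m ] → b ≋ d [ m ] → y * a + x * b ≋ y * c + x * d [ m ]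
form-cong x y p q = mod-+ (mod-*ˡ y p) (mod-*ˡ x q)

-- (1 + m z)^k ≡ 1 + k m z modulo m ρ because ρ divides m: the form at the shifted index carries a
-- factor m, so its value modulo ρ suffices, and there `k * π` is a period.
shift-* : ∀ {π} → Shift x y ρ m π → ρ ℕ.∣ m → IsGib s → ∀ k n →
          s (k ℕ.* π ℕ.+ n) ≋ s n + + k * (+ m * (y * s n + x * s (suc n))) [ m ℕ.* ρ ]
shift-* {x} {y} {ρ} {m} {s} {π} S ρ∣m gs zero n = mod-reflexive (lemma (s n) (+ m * (y * s n + x * s (suc n))))
  where
  lemma : ∀ a b → a ≡ a + + 0 * b
  lemma = solve-∀
shift-* {x} {y} {ρ} {m} {s} {π} S ρ∣m gs (suc k) n = begin
  s (π ℕ.+ k ℕ.* π ℕ.+ n)                ≡⟨ cong s (ℕ.+-assoc π (k ℕ.* π) n) ⟩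
  s (π ℕ.+ i)                            ≈⟨ shifted S gs i ⟩
  s i + + m * (y * s i + x * s (suc i))  ≈⟨ mod-+ (shift-* S ρ∣m gs k n) (mod-scale m (form-cong x y
      (mod-∣ ρ∣m (per gs n))
      (mod-∣ ρ∣m (mod-trans (mod-reflexive (cong s (sym (ℕ.+-suc (k ℕ.* π) n)))) (per gs (suc n)))))) ⟩
  s n + + k * h + h                      ≡⟨ lemma (s n) (+ k) h ⟩
  s n + + suc k * h                      ∎
  where
  open mod-Reasoning (m ℕ.* ρ)
  i = k ℕ.* π ℕ.+ n
  h = + m * (y * s n + x * s (suc n))
  per : Period m (k ℕ.* π)
  per = period-* (shift⇒period S) k
  lemma : ∀ a k h → a + k * h + h ≡ a + (+ 1 + k) * h
  lemma = solve-∀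

good-lift : ∀ {π} .{{_ : ℕ.NonZero ρ}} → Shift x y ρ m π → ρ ℕ.∣ m → q ℕ.∣ ρ → IsGib s →
            Good s x y ρ m → Good s x y ρ (m ℕ.* q)
good-lift {ρ} {x} {y} {m} {q} {s} {π} S ρ∣m q∣ρ gs g = good go
  where
  go : ∀ r → ∃[ n ] s n ≋ r [ m ℕ.* q ] × ∃[ v ] v * (y * s n + x * s (suc n)) ≋ + 1 [ ρ ]
  go r with hit g r
  ... | n , mod (divides c c-eq) , v , ve = k ℕ.* π ℕ.+ n , first , v , second
    where
    h = y * s n + x * s (suc n)
    -- With s n - r = c m, moving by `k * π` adds k m h, so k h ≡ -c modulo ρ is wanted, and `v`
    -- inverts `h`. The residue makes `k` a natural number.
    k = (- c * v) %ℕ ρ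
    first : s (k ℕ.* π ℕ.+ n) ≋ r [ m ℕ.* q ]
    first = mod-∣ (ℕ.*-monoʳ-∣ m q∣ρ) (begin
      s (k ℕ.* π ℕ.+ n)             ≈⟨ shift-* S ρ∣m gs k n ⟩
      s n + + k * (+ m * h)         ≡⟨ lemma₁ (s n) (+ k) (+ m) h ⟩
      s n + + m * (+ k * h)         ≈⟨ mod-+ˡ (s n) (mod-scale m (mod-*ʳ h (mod-sym (mod-%ℕ (- c * v) ρ)))) ⟩
      s n + + m * (- c * v * h)     ≡⟨ lemma₂ (s n) (+ m) c v h ⟩
      s n + + m * (- c * (v * h))   ≈⟨ mod-+ˡ (s n) (mod-scale m (mod-*ˡ ( - c) ve)) ⟩
      s n + + m * (- c * + 1)       ≡⟨ lemma₃ (s n) (+ m) c ⟩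
      s n - c * + m                 ≡⟨ cong (λ t → s n - t) c-eq ⟨
      s n - (s n - r)               ≡⟨ lemma₄ (s n) r ⟩
      r                             ∎)
      where
      open mod-Reasoning (m ℕ.* ρ)
      lemma₁ : ∀ a k m h → a + k * (m * h) ≡ a + m * (k * h)
      lemma₁ = solve-∀
      lemma₂ : ∀ a m c v h → a + m * (- c * v * h) ≡ a + m * (- c * (v * h))
      lemma₂ = solve-∀
      lemma₃ : ∀ a m c → a + m * (- c * + 1) ≡ a - c * m
      lemma₃ = solve-∀
      lemma₄ : ∀ a r → a - (a - r) ≡ r
      lemma₄ = solve-∀
    per : Period m (k ℕ.* π)
    per = period-* (shift⇒period S) k
    second : v * (y * s (k ℕ.* π ℕ.+ n) + x * s (suc (k ℕ.* π ℕ.+ n))) ≋ + 1 [ ρ ]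
    second = mod-trans (mod-*ˡ v (form-cong x y
      (mod-∣ ρ∣m (per gs n))
      (mod-∣ ρ∣m (mod-trans (mod-reflexive (cong s (sym (ℕ.+-suc (k ℕ.* π) n)))) (per gs (suc n)))))) ve

difference : ℕ → (ℕ → ℤ) → ℕ → ℤ
difference π s n = s (π ℕ.+ n) - s n

difference-isGib : ∀ π → IsGib s → IsGib (difference π s)
difference-isGib {s} π gs = gib λ n → trans
  (cong₂ _-_ (trans (cong s (trans (ℕ.+-suc π (suc n)) (cong suc (ℕ.+-suc π n)))) (recurrence gs (π ℕ.+ n))) (recurrence gs n))
  (trans (lemma (s (π ℕ.+ n)) (s (suc (π ℕ.+ n))) (s n) (s (suc n)))
         (cong (λ i → (s (π ℕ.+ n) - s n) + (s i - s (suc n))) (sym (ℕ.+-suc π n))))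
  where
  lemma : ∀ a b c d → (a + b) - (c + d) ≡ (a - c) + (b - d)
  lemma = solve-∀

-- Divisibility of the first two terms makes `s` a multiple of another Gibonacci sequence `t`, and
-- S^π ≡ 1 applied to `t` gives the factor `m`. So each application of `difference π` gains a factor
-- `m`.
difference-divisible : ∀ {π} → Period m π → IsGib s → (∀ n → s n ≋ + 0 [ l ]) →
                       ∀ n → difference π s n ≋ + 0 [ l ℕ.* m ]
difference-divisible {m} {s} {k} {π} per gs z n
  with ≋0⇒∣ (z 0) | ≋0⇒∣ (z 1)
... | divides a a-eq | divides b b-eq = begin
  s (π ℕ.+ n) - s n             ≡⟨ cong₂ _-_ (s≡kt (π ℕ.+ n)) (s≡kt n) ⟩
  + k * t (π ℕ.+ n) - + k * t n ≈⟨ mod-- (mod-scale k (per gt n)) (mod-refl {+ k * t n}) ⟩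
  + k * t n - + k * t n         ≡⟨ ℤ.+-inverseʳ (+ k * t n) ⟩
  + 0                           ∎
  where
  open mod-Reasoning (k ℕ.* m)
  t = G a b
  gt : IsGib t
  gt = G-isGib a b
  s≡kt : ∀ n → s n ≡ + k * t n
  s≡kt = gib-unique gs (gib λ n → ℤ.*-distribˡ-+ (+ k) (t n) (t (suc n)))
    (trans a-eq (ℤ.*-comm a (+ k))) (trans b-eq (ℤ.*-comm b (+ k)))

-- The binomial coefficient k(k - 1)/2, in the recursive form that the induction step of Newton's
-- formula produces.
triangular : ℕ → ℕ
triangular zero    = 0
triangular (suc k) = triangular k ℕ.+ k

-- Newton's forward difference formula to second order.
second-order : ∀ {π} → Period m π → IsGib s → ∀ k n →
  s (k ℕ.* π ℕ.+ n) ≋ s n + + k * difference π s n + + triangular k * difference π (difference π s) n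
    [ m ℕ.* m ℕ.* m ]
second-order {m} {s} {π} per gs zero n = mod-reflexive (lemma (s n) (difference π s n) (difference π (difference π s) n))
  where
  lemma : ∀ a b c → a ≡ a + + 0 * b + + 0 * c
  lemma = solve-∀
second-order {m} {s} {π} per gs (suc k) n = begin
  s (π ℕ.+ k ℕ.* π ℕ.+ n)                       ≡⟨ cong s (trans (cong (ℕ._+ n) (ℕ.+-comm π (k ℕ.* π))) (ℕ.+-assoc (k ℕ.* π) π n)) ⟩
  s (k ℕ.* π ℕ.+ (π ℕ.+ n))                     ≈⟨ second-order per gs k (π ℕ.+ n) ⟩
  s (π ℕ.+ n) + + k * d (π ℕ.+ n) + + triangular k * e (π ℕ.+ n)
      ≡⟨ lemma₁ (s (π ℕ.+ n)) (s n) (+ k) (d (π ℕ.+ n)) (d n) (+ triangular k) (e (π ℕ.+ n)) (e n) ⟩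
  s n + d n + + k * (d n + e n) + + triangular k * (e n + (e (π ℕ.+ n) - e n))
      ≈⟨ mod-+ˡ (s n + d n + + k * (d n + e n)) (mod-*ˡ (+ triangular k) (mod-+ˡ (e n) third)) ⟩
  s n + d n + + k * (d n + e n) + + triangular k * (e n + + 0)
      ≡⟨ lemma₂ (s n) (+ k) (d n) (+ triangular k) (e n) ⟩
  s n + + suc k * d n + + triangular (suc k) * e n  ∎
  where
  open mod-Reasoning (m ℕ.* m ℕ.* m)
  d = difference π s
  e = difference π d
  gd = difference-isGib π gs
  -- Three differences gain the factor `m` three times, starting from divisibility by 1.
  third : e (π ℕ.+ n) - e n ≋ + 0 [ m ℕ.* m ℕ.* m ]
  third = difference-divisible per (difference-isGib π gd)
    (difference-divisible per gd λ i → subst (λ m → d i ≋ + 0 [ m ]) (ℕ.*-identityˡ m)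
      (difference-divisible per gs (λ j → mod (∣ᵤ⇒∣ (ℕ.1∣ _))) i)) n
  lemma₁ : ∀ a b k d′ d t e′ e → a + k * d′ + t * e′ ≡
           b + (a - b) + k * (d + (d′ - d)) + t * (e + (e′ - e))
  lemma₁ = solve-∀
  lemma₂ : ∀ a k d t e → a + d + k * (d + e) + t * (e + + 0) ≡ a + (+ 1 + k) * d + (t + k) * e
  lemma₂ = solve-∀

-- The linear term is q times a congruence modulo m ρ; the quadratic term is divisible by q m²,
-- since q divides q(q - 1)/2; the rest vanishes modulo m³. As q divides ρ and ρ divides m, all
-- three moduli are multiples of m q ρ.
shift-lift : ∀ {π} → Shift x y ρ m π → ρ ℕ.∣ m → q ℕ.∣ ρ → q ℕ.∣ triangular q →
             Shift x y ρ (m ℕ.* q) (q ℕ.* π)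
shift-lift {x} {y} {ρ} {m} {q} {π} S ρ∣m q∣ρ (ℕ.divides c c-eq) = shift go
  where
  per : Period m π
  per = shift⇒period S
  N = m ℕ.* q ℕ.* ρ
  q*ρ∣m*m : q ℕ.* ρ ℕ.∣ m ℕ.* m
  q*ρ∣m*m = ℕ.*-pres-∣ (ℕ.∣-trans q∣ρ ρ∣m) ρ∣m
  N∣m³ : N ℕ.∣ m ℕ.* m ℕ.* m
  N∣m³ = subst₂ ℕ._∣_ (sym (ℕ.*-assoc m q ρ)) (sym (ℕ.*-assoc m m m)) (ℕ.*-monoʳ-∣ m q*ρ∣m*m)
  N≡ : q ℕ.* (m ℕ.* ρ) ≡ N
  N≡ = trans (sym (ℕ.*-assoc q m ρ)) (cong (ℕ._* ρ) (ℕ.*-comm q m))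
  go : ∀ {s} → IsGib s → ∀ n → s (q ℕ.* π ℕ.+ n) ≋ s n + + (m ℕ.* q) * (y * s n + x * s (suc n)) [ N ]
  go {s} gs n = begin
    s (q ℕ.* π ℕ.+ n)                                ≈⟨ mod-∣ N∣m³ (second-order per gs q n) ⟩
    s n + + q * d n + + triangular q * e n           ≈⟨ mod-+ (mod-+ˡ (s n) first) second ⟩
    s n + + q * (+ m * h) + + 0                      ≡⟨ lemma (s n) (+ q) (+ m) h ⟩
    s n + + m * + q * h                              ≡⟨ cong (λ t → s n + t * h) (ℤ.pos-* m q) ⟨
    s n + + (m ℕ.* q) * h                            ∎
    where
    open mod-Reasoning N
    h = y * s n + x * s (suc n)
    d = difference π s
    e = difference π d
    lemma : ∀ a q m h → a + q * (m * h) + + 0 ≡ a + m * q * h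
    lemma = solve-∀
    lemma′ : ∀ a b → (a + b) - a ≡ b
    lemma′ = solve-∀
    first : + q * d n ≋ + q * (+ m * h) [ N ]
    first = subst (+ q * d n ≋ + q * (+ m * h) [_]) N≡ (mod-scale q (mod-trans
      (mod-- (shifted S gs n) (mod-refl {s n})) (mod-reflexive (lemma′ (s n) (+ m * h)))))
    e≋0 : e n ≋ + 0 [ m ℕ.* m ]
    e≋0 = difference-divisible per (difference-isGib π gs) (λ i → mod-trans
      (mod-- (per gs i) (mod-refl {s i})) (mod-reflexive (ℤ.+-inverseʳ (s i)))) n
    second : + triangular q * e n ≋ + 0 [ N ]
    second = begin
      + triangular q * e n   ≡⟨ cong (λ t → + t * e n) c-eq ⟩
      + (c ℕ.* q) * e n      ≡⟨ cong (_* e n) (ℤ.pos-* c q) ⟩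
      + c * + q * e n        ≡⟨ ℤ.*-assoc (+ c) (+ q) (e n) ⟩
      + c * (+ q * e n)      ≈⟨ mod-*ˡ (+ c) (subst (+ q * e n ≋ + q * + 0 [_]) N≡
                                  (mod-scale q (mod-∣ (ℕ.*-monoʳ-∣ m ρ∣m) e≋0))) ⟩
      + c * (+ q * + 0)      ≡⟨ lemma₀ (+ c) (+ q) ⟩
      + 0                    ∎
      where
      lemma₀ : ∀ c q → c * (q * + 0) ≡ + 0
      lemma₀ = solve-∀

-- Computations modulo m

walk : (m : ℕ) .{{_ : ℕ.NonZero m}} → ℕ → ℕ × ℕ → ℕ × ℕ
walk m zero    (a , b) = a , b
-- Forcing each term keeps evaluation linear in the number of steps.
walk m (suc n) (a , b) = force ((a ℕ.+ b) % m) λ c → walk m n (b , c)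

walk-sound : ∀ m .{{_ : ℕ.NonZero m}} n {a b} → IsGib s → + a ≋ s 0 [ m ] → + b ≋ s 1 [ m ] →
             + proj₁ (walk m n (a , b)) ≋ s n [ m ] × + proj₂ (walk m n (a , b)) ≋ s (suc n) [ m ]
walk-sound m zero gs ea eb = ea , eb
walk-sound {s} m (suc n) {a} {b} gs ea eb rewrite force-≡ ((a ℕ.+ b) % m) (λ c → walk m n (b , c)) = walk-sound {λ i → s (suc i)} m n (gib λ i → recurrence gs (suc i)) eb (begin
  + ((a ℕ.+ b) % m)   ≈⟨ mod-%ℕ (+ (a ℕ.+ b)) m ⟨
  + a + + b           ≈⟨ mod-+ ea eb ⟩
  s 0 + s 1           ≡⟨ recurrence gs 0 ⟨
  s 2                 ∎)
  where open mod-Reasoning m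

F-walk : ∀ m .{{_ : ℕ.NonZero m}} n →
         + proj₁ (walk m n (0 , 1)) ≋ F n [ m ] × + proj₂ (walk m n (0 , 1)) ≋ F (suc n) [ m ]
F-walk m n = walk-sound m n (G-isGib (+ 0) (+ 1)) mod-refl mod-refl

-- S^π = F_π S + F_{π-1} has the form 1 + m (y + x S) when F_π = m x and F_{π+1} = 1 + m (x + y),
-- which the computed pair shows modulo m ρ.
shift-compute : ∀ x y ρ m π .{{_ : ℕ.NonZero (m ℕ.* ρ)}} →
                walk (m ℕ.* ρ) π (0 , 1) ≡ ((m ℕ.* x) % (m ℕ.* ρ) , (1 ℕ.+ m ℕ.* (x ℕ.+ y)) % (m ℕ.* ρ)) →
                Shift (+ x) (+ y) ρ m π
shift-compute x y ρ m π eq = shift λ {s} gs n → begin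
  s (π ℕ.+ n)                                   ≡⟨ gib-+ gs π n ⟩
  F π * s (suc n) + (F (suc π) - F π) * s n     ≈⟨ mod-+ (mod-*ʳ (s (suc n)) eπ) (mod-*ʳ (s n) (mod-- eπ₁ eπ)) ⟩
  + m * + x * s (suc n) + ((+ 1 + + m * (+ x + + y)) - + m * + x) * s n
                                                ≡⟨ lemma (+ m) (+ x) (+ y) (s n) (s (suc n)) ⟩
  s n + + m * (+ y * s n + + x * s (suc n))     ∎
  where
  open mod-Reasoning (m ℕ.* ρ)
  N = m ℕ.* ρ
  lemma : ∀ m x y a b → m * x * b + ((+ 1 + m * (x + y)) - m * x) * a ≡ a + m * (y * a + x * b)
  lemma = solve-∀
  eπ : F π ≋ + m * + x [ N ]
  eπ = begin
    F π                              ≈⟨ proj₁ (F-walk N π) ⟨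
    + proj₁ (walk N π (0 , 1))       ≡⟨ cong (λ p → + proj₁ p) eq ⟩
    + ((m ℕ.* x) % N)                ≈⟨ mod-%ℕ (+ (m ℕ.* x)) N ⟨
    + (m ℕ.* x)                      ≡⟨ ℤ.pos-* m x ⟩
    + m * + x                        ∎
  eπ₁ : F (suc π) ≋ + 1 + + m * (+ x + + y) [ N ]
  eπ₁ = begin
    F (suc π)                            ≈⟨ proj₂ (F-walk N π) ⟨
    + proj₂ (walk N π (0 , 1))           ≡⟨ cong (λ p → + proj₂ p) eq ⟩
    + ((1 ℕ.+ m ℕ.* (x ℕ.+ y)) % N)      ≈⟨ mod-%ℕ (+ (1 ℕ.+ m ℕ.* (x ℕ.+ y))) N ⟨
    + 1 + + (m ℕ.* (x ℕ.+ y))            ≡⟨ cong (λ t → + 1 + t) (ℤ.pos-* m (x ℕ.+ y)) ⟩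
    + 1 + + m * (+ x + + y)              ∎

-- The inverse `v` ranges over residues to keep the condition decidable. Writing `1 % ρ` lets `ρ` =
-- 1 stand for no unit condition.
GoodAt : ∀ x y ρ m .{{_ : ℕ.NonZero ρ}} .{{_ : ℕ.NonZero m}} → ℕ → Fin m → Fin ρ → Set
GoodAt x y ρ m n r v = proj₁ st ≡ toℕ r × (toℕ v ℕ.* (y ℕ.* proj₁ st ℕ.+ x ℕ.* proj₂ st)) % ρ ≡ 1 % ρ
  where st = walk m n (0 , 1)

goodAt? : ∀ x y ρ m .{{_ : ℕ.NonZero ρ}} .{{_ : ℕ.NonZero m}} n r v → Dec (GoodAt x y ρ m n r v)
goodAt? x y ρ m n r v = (_ ℕ.≟ _) ×-dec (_ ℕ.≟ _)

good-compute : ∀ x y ρ m K .{{_ : ℕ.NonZero ρ}} .{{_ : ℕ.NonZero m}} → ρ ℕ.∣ m →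
  True (Fin.all? λ r → Fin.any? {K} λ i → Fin.any? λ v → goodAt? x y ρ m (toℕ i) r v) →
  Good F (+ x) (+ y) ρ m
good-compute x y ρ m K ρ∣m check = good go
  where
  go : ∀ r → ∃[ n ] F n ≋ r [ m ] × ∃[ v ] v * (+ y * F n + + x * F (suc n)) ≋ + 1 [ ρ ]
  go r with toWitness check (residue m r)
  ... | i , v , e , ve = toℕ i , first , + toℕ v , second
    where
    st = walk m (toℕ i) (0 , 1)
    first : F (toℕ i) ≋ r [ m ]
    first = begin
      F (toℕ i)              ≈⟨ proj₁ (F-walk m (toℕ i)) ⟨
      + proj₁ st             ≡⟨ cong +_ (trans e (Fin.toℕ-fromℕ< (n%ℕd<d r m))) ⟩
      + (r %ℕ m)             ≈⟨ mod-%ℕ r m ⟨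
      r                      ∎
      where open mod-Reasoning m
    second : + toℕ v * (+ y * F (toℕ i) + + x * F (suc (toℕ i))) ≋ + 1 [ ρ ]
    second = begin
      + toℕ v * (+ y * F (toℕ i) + + x * F (suc (toℕ i)))
        ≈⟨ mod-*ˡ (+ toℕ v) (form-cong (+ x) (+ y) (mod-∣ ρ∣m (proj₁ (F-walk m (toℕ i)))) (mod-∣ ρ∣m (proj₂ (F-walk m (toℕ i))))) ⟨
      + toℕ v * (+ y * + proj₁ st + + x * + proj₂ st)
        ≡⟨ cong (λ t → + toℕ v * t) (cong₂ _+_ (ℤ.pos-* y (proj₁ st)) (ℤ.pos-* x (proj₂ st))) ⟨
      + toℕ v * + (y ℕ.* proj₁ st ℕ.+ x ℕ.* proj₂ st)
        ≡⟨ ℤ.pos-* (toℕ v) _ ⟨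
      + (toℕ v ℕ.* (y ℕ.* proj₁ st ℕ.+ x ℕ.* proj₂ st))
        ≈⟨ %ℕ-injective (+ (toℕ v ℕ.* (y ℕ.* proj₁ st ℕ.+ x ℕ.* proj₂ st))) (+ 1) ρ ve ⟩
      + 1  ∎
      where open mod-Reasoning ρ

-- The period changes at each lift, so it is hidden together with the coefficients; what remains is
-- a property of the modulus that multiplication by `q` preserves.
record Liftable (s : ℕ → ℤ) (ρ m : ℕ) : Set where
  field
    {c d}          : ℤ
    {π}            : ℕ
    .{{ρ-nonZero}} : ℕ.NonZero ρ
    ρ∣m            : ρ ℕ.∣ m
    hasShift       : Shift c d ρ m π
    isGood         : Good s c d ρ m

liftable⇒complete : Liftable s ρ m → Complete s m
liftable⇒complete L = good⇒complete (Liftable.isGood L)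

lift-* : IsGib s → q ℕ.∣ ρ → q ℕ.∣ triangular q → Liftable s ρ m → Liftable s ρ (m ℕ.* q)
lift-* {q = q} gs q∣ρ q∣t L = record
  { ρ∣m      = ℕ.∣m⇒∣m*n q ρ∣m
  ; hasShift = shift-lift hasShift ρ∣m q∣ρ q∣t
  ; isGood   = good-lift hasShift ρ∣m q∣ρ gs isGood
  }
  where open Liftable L

lift-^ : IsGib s → q ℕ.∣ ρ → q ℕ.∣ triangular q → Liftable s ρ m → ∀ k → Liftable s ρ (m ℕ.* q ^ k)
lift-^ {m = m} gs q∣ρ q∣t L zero = subst (Liftable _ _) (sym (ℕ.*-identityʳ m)) L
lift-^ {q = q} {m = m} gs q∣ρ q∣t L (suc k) = subst (Liftable _ _)
  (trans (ℕ.*-assoc m (q ^ k) q) (cong (m ℕ.*_) (ℕ.*-comm (q ^ k) q)))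
  (lift-* gs q∣ρ q∣t (lift-^ gs q∣ρ q∣t L k))

F-liftable⇒liftable : IsGib s → Primitive (s 0) (s 1) → ∀ n → s n ≋ + 0 [ m ] →
                      Liftable F ρ m → Liftable s ρ m
F-liftable⇒liftable gs prim n e L = record
  { ρ∣m      = ρ∣m
  ; hasShift = hasShift
  ; isGood   = F-good⇒good gs prim n e ρ∣m isGood
  }
  where open Liftable L

-- Completeness for the listed moduli

HasZero : (ℕ → ℤ) → ℕ → Set
HasZero s m = ∃[ n ] s n ≋ + 0 [ m ]

-- Past a zero, `s` is F times a constant, so zeros recur with step `π` as soon as F π ≡ 0, even
-- when `π` is not a period.
zero-+* : ∀ {π} → F π ≋ + 0 [ m ] → IsGib s → ∀ n → s n ≋ + 0 [ m ] → ∀ k → s (k ℕ.* π ℕ.+ n) ≋ + 0 [ m ]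
zero-+* Fπ gs n e zero = e
zero-+* {m} {s} {π} Fπ gs n e (suc k) = begin
  s (π ℕ.+ k ℕ.* π ℕ.+ n)     ≡⟨ cong s (ℕ.+-assoc π (k ℕ.* π) n) ⟩
  s (π ℕ.+ i)                 ≈⟨ zero-shift gs i (zero-+* Fπ gs n e k) π ⟩
  F π * s (suc i)             ≈⟨ mod-*ʳ (s (suc i)) Fπ ⟩
  + 0 * s (suc i)             ≡⟨⟩
  + 0                         ∎
  where
  open mod-Reasoning m
  i = k ℕ.* π ℕ.+ n

mod-coprime : ∀ {a b} → Coprime a b → x ≋ + 0 [ a ] → x ≋ + 0 [ b ] → x ≋ + 0 [ a ℕ.* b ]
mod-coprime {x} {a} {b} co ea eb with ∣⇒∣ᵤ (≋0⇒∣ eb)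
... | ℕ.divides c c-eq = ∣⇒≋0 (∣ᵤ⇒∣ (subst (a ℕ.* b ℕ.∣_) (sym c-eq) (ℕ.*-monoˡ-∣ b a∣c)))
  where
  a∣c : a ℕ.∣ c
  a∣c = coprime-divisor co (subst (a ℕ.∣_) (trans c-eq (ℕ.*-comm c b)) (∣⇒∣ᵤ (≋0⇒∣ ea)))

-- 25 n₀ + 96 n₁ is n₀ modulo 24 and n₁ modulo 5.
zero-5* : Coprime m 5 → F 24 ≋ + 0 [ m ] → IsGib s → HasZero s m → HasZero s 5 → HasZero s (m ℕ.* 5)
zero-5* {m} {s} co F24 gs (n₀ , e₀) (n₁ , e₁) = n , mod-coprime co
  (subst (λ i → s i ≋ + 0 [ m ]) (lemma₀ n₀ n₁) (zero-+* F24 gs n₀ e₀ (n₀ ℕ.+ 4 ℕ.* n₁)))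
  (subst (λ i → s i ≋ + 0 [ 5 ]) (lemma₁ n₀ n₁) (zero-+* {π = 5} (mod (divides (+ 1) refl)) gs n₁ e₁ (5 ℕ.* n₀ ℕ.+ 19 ℕ.* n₁)))
  where
  n = 25 ℕ.* n₀ ℕ.+ 96 ℕ.* n₁
  lemma₀ : ∀ a b → (a ℕ.+ 4 ℕ.* b) ℕ.* 24 ℕ.+ a ≡ 25 ℕ.* a ℕ.+ 96 ℕ.* b
  lemma₀ = ℕRing.solve-∀
  lemma₁ : ∀ a b → (5 ℕ.* a ℕ.+ 19 ℕ.* b) ℕ.* 5 ℕ.+ b ≡ 25 ℕ.* a ℕ.+ 96 ℕ.* b
  lemma₁ = ℕRing.solve-∀

CommonFactor : ℕ → ℕ → ℕ → ℕ → Set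
CommonFactor m a b d = 2 ≤ d × d ℕ.∣ m × d ℕ.∣ a × d ℕ.∣ b

commonFactor? : ∀ m a b d → Dec (CommonFactor m a b d)
commonFactor? m a b d = (2 ℕ.≤? d) ×-dec (d ℕ.∣? m) ×-dec (d ℕ.∣? a) ×-dec (d ℕ.∣? b)

primitive⇒¬commonFactor : ∀ {x y a b d} → Primitive x y → x ≋ + a [ m ] → y ≋ + b [ m ] → ¬ CommonFactor m a b d
primitive⇒¬commonFactor {m} {x} {y} {a} {b} {d} (u , v , eq) ex ey (2≤d , d∣m , d∣a , d∣b) =
  ℕ.≤⇒≯ (ℕ.≤-reflexive (ℕ.∣1⇒≡1 (∣⇒∣ᵤ (≋0⇒∣ 1≋0)))) 2≤d
  where
  open mod-Reasoning d
  lemma : ∀ u v → u * + 0 + v * + 0 ≡ + 0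
  lemma = solve-∀
  x≋0 : x ≋ + 0 [ d ]
  x≋0 = mod-trans (mod-∣ d∣m ex) (∣⇒≋0 (∣ᵤ⇒∣ d∣a))
  y≋0 : y ≋ + 0 [ d ]
  y≋0 = mod-trans (mod-∣ d∣m ey) (∣⇒≋0 (∣ᵤ⇒∣ d∣b))
  1≋0 : + 1 ≋ + 0 [ d ]
  1≋0 = begin
    + 1                ≡⟨ eq ⟨
    u * x + v * y      ≈⟨ form-cong v u x≋0 y≋0 ⟩
    u * + 0 + v * + 0  ≡⟨ lemma u v ⟩
    + 0                ∎

walk-zero : ∀ m .{{_ : ℕ.NonZero m}} n {a b} → IsGib s → s 0 ≋ + a [ m ] → s 1 ≋ + b [ m ] →
            proj₁ (walk m n (a , b)) ≡ 0 → s n ≋ + 0 [ m ]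
walk-zero m n gs ea eb eq = mod-trans
  (mod-sym (proj₁ (walk-sound m n gs (mod-sym ea) (mod-sym eb)))) (mod-reflexive (cong +_ eq))

residue-≋ : ∀ m .{{_ : ℕ.NonZero m}} x → x ≋ + toℕ (residue m x) [ m ]
residue-≋ m x = mod-trans (mod-%ℕ x m) (mod-reflexive (cong +_ (sym (Fin.toℕ-fromℕ< (n%ℕd<d x m)))))

-- A pair of residues that reaches no zero must share a factor with `m`, which primitivity excludes.
-- For the moduli used below F 24 ≡ 0, so zeros recur with step 24 and 24 indices decide the matter.
hasZero-compute : ∀ m .{{_ : ℕ.NonZero m}} →
  True (Fin.all? {m} λ a → Fin.all? {m} λ b →
    (Fin.any? {24} λ i → proj₁ (walk m (toℕ i) (toℕ a , toℕ b)) ℕ.≟ 0) ⊎-dec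
    (Fin.any? {suc m} λ d → commonFactor? m (toℕ a) (toℕ b) (toℕ d))) →
  IsGib s → Primitive (s 0) (s 1) → HasZero s m
hasZero-compute {s} m check gs prim with toWitness check (residue m (s 0)) (residue m (s 1))
... | inj₁ (i , e)  = toℕ i , walk-zero m (toℕ i) gs (residue-≋ m (s 0)) (residue-≋ m (s 1)) e
... | inj₂ (d , cf) = ⊥-elim (primitive⇒¬commonFactor prim (residue-≋ m (s 0)) (residue-≋ m (s 1)) cf)

hasZero-5 : IsGib s → ¬ Δ (s 0) (s 1) ≋ + 0 [ 5 ] → HasZero s 5
hasZero-5 {s} gs Δ≢0 with check (residue 5 (s 0)) (residue 5 (s 1))
  where
  -- `4 * b²` replaces `- b²` to stay in ℕ. Five indices suffice because F 5 = 5.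
  check : ∀ (a b : Fin 5) → (∃[ i ] proj₁ (walk 5 (toℕ {5} i) (toℕ a , toℕ b)) ≡ 0) ⊎
          ((toℕ a ℕ.* toℕ a ℕ.+ toℕ a ℕ.* toℕ b ℕ.+ 4 ℕ.* (toℕ b ℕ.* toℕ b)) % 5 ≡ 0)
  check = toWitness {a? = Fin.all? λ a → Fin.all? λ b → (Fin.any? λ i → _ ℕ.≟ _) ⊎-dec (_ ℕ.≟ _)} _
... | inj₁ (i , e) = toℕ i , walk-zero 5 (toℕ i) gs (residue-≋ 5 (s 0)) (residue-≋ 5 (s 1)) e
... | inj₂ e       = ⊥-elim (Δ≢0 (begin
  Δ (s 0) (s 1)                                  ≈⟨ mod-- (mod-+ (mod-* ea ea) (mod-* ea eb)) (mod-* eb eb) ⟩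
  + a * + a + + a * + b - + b * + b              ≡⟨ lemma (+ a) (+ b) ⟩
  (+ a * + a + + a * + b + + 4 * (+ b * + b)) + + 5 * - (+ b * + b) ≈⟨ mod-+ˡ (+ a * + a + + a * + b + + 4 * (+ b * + b)) (self≋0 5 (- (+ b * + b))) ⟩
  (+ a * + a + + a * + b + + 4 * (+ b * + b)) + + 0  ≡⟨ ℤ.+-identityʳ _ ⟩
  + a * + a + + a * + b + + 4 * (+ b * + b)      ≡⟨ cong₂ (λ t u → t + + 4 * u) (cong₂ _+_ (ℤ.pos-* a a) (ℤ.pos-* a b)) (ℤ.pos-* b b) ⟨
  + (a ℕ.* a ℕ.+ a ℕ.* b) + + 4 * + (b ℕ.* b)    ≡⟨ cong (λ t → + (a ℕ.* a ℕ.+ a ℕ.* b) + t) (ℤ.pos-* 4 (b ℕ.* b)) ⟨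
  + (a ℕ.* a ℕ.+ a ℕ.* b ℕ.+ 4 ℕ.* (b ℕ.* b))    ≈⟨ %ℕ-injective (+ (a ℕ.* a ℕ.+ a ℕ.* b ℕ.+ 4 ℕ.* (b ℕ.* b))) (+ 0) 5 e ⟩
  + 0                                            ∎))
  where
  open mod-Reasoning 5
  a = toℕ (residue 5 (s 0))
  b = toℕ (residue 5 (s 1))
  ea : s 0 ≋ + a [ 5 ]
  ea = residue-≋ 5 (s 0)
  eb : s 1 ≋ + b [ 5 ]
  eb = residue-≋ 5 (s 1)
  lemma : ∀ a b → a * a + a * b - b * b ≡ (a * a + a * b + + 4 * (b * b)) + + 5 * - (b * b)
  lemma = solve-∀

record ZeroBase (m : ℕ) : Set where
  field
    coprime-5 : Coprime m 5
    F24≋0     : F 24 ≋ + 0 [ m ]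
    hasZero   : ∀ {s} → IsGib s → Primitive (s 0) (s 1) → HasZero s m

  hasZero-*5 : IsGib s → Primitive (s 0) (s 1) → ¬ Δ (s 0) (s 1) ≋ + 0 [ 5 ] → HasZero s (m ℕ.* 5)
  hasZero-*5 gs prim Δ≢0 = zero-5* coprime-5 F24≋0 gs (hasZero gs prim) (hasZero-5 gs Δ≢0)

zeroBase-compute : ∀ m .{{_ : ℕ.NonZero m}} → True (coprime? m 5) → proj₁ (walk m 24 (0 , 1)) ≡ 0 →
  True (Fin.all? {m} λ a → Fin.all? {m} λ b →
    (Fin.any? {24} λ i → proj₁ (walk m (toℕ i) (toℕ a , toℕ b)) ℕ.≟ 0) ⊎-dec
    (Fin.any? {suc m} λ d → commonFactor? m (toℕ a) (toℕ b) (toℕ d))) →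
  ZeroBase m
zeroBase-compute m co F24 check = record
  { coprime-5 = toWitness co
  ; F24≋0     = mod-trans (mod-sym (proj₁ (F-walk m 24))) (mod-reflexive (cong +_ F24))
  ; hasZero   = hasZero-compute m check
  }

-- Lifting by 5 needs a modulus divisible by 5, so it starts at 5m; the modulus m itself is treated
-- apart, with `ρ` = 1.
record Base (m : ℕ) : Set where
  field
    zeroBase   : ZeroBase m
    F-good     : Good F (+ 0) (+ 0) 1 m
    F-liftable : Liftable F 5 (m ℕ.* 5)

  open ZeroBase zeroBase

  complete : IsGib s → Primitive (s 0) (s 1) → Complete s m
  complete gs prim = let n , e = hasZero gs prim in
    good⇒complete (F-good⇒good gs prim n e (ℕ.1∣ m) F-good)

  complete-5^ : IsGib s → Primitive (s 0) (s 1) → ¬ Δ (s 0) (s 1) ≋ + 0 [ 5 ] → ∀ k → Complete s (m ℕ.* 5 ^ k)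
  complete-5^ gs prim Δ≢0 zero = subst (Complete _) (sym (ℕ.*-identityʳ m)) (complete gs prim)
  -- The zero modulo 5m serves to pass from F to `s`; the lifting then runs on `s` itself, so no
  -- zeros modulo higher powers have to be found.
  complete-5^ gs prim Δ≢0 (suc k) = let n , e = hasZero-*5 gs prim Δ≢0 in
    subst (Complete _) (ℕ.*-assoc m 5 (5 ^ k)) (liftable⇒complete
      (lift-^ gs ℕ.∣-refl (ℕ.divides 2 refl) (F-liftable⇒liftable gs prim n e F-liftable) k))

-- Every m used below divides 84, and F 240 = 420 X, F 241 = 1 + 420 Z; so x ≡ (84 / m) X and
-- x + y ≡ (84 / m) Z modulo 5.
base-compute : ∀ x y m .{{_ : ℕ.NonZero m}} .{{_ : ℕ.NonZero (m ℕ.* 5)}} .{{_ : ℕ.NonZero (m ℕ.* 5 ℕ.* 5)}} →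
  ZeroBase m →
  True (Fin.all? λ r → Fin.any? {48} λ i → Fin.any? λ v → goodAt? 0 0 1 m (toℕ i) r v) →
  walk (m ℕ.* 5 ℕ.* 5) 240 (0 , 1) ≡
    ((m ℕ.* 5 ℕ.* x) % (m ℕ.* 5 ℕ.* 5) , (1 ℕ.+ m ℕ.* 5 ℕ.* (x ℕ.+ y)) % (m ℕ.* 5 ℕ.* 5)) →
  True (Fin.all? λ r → Fin.any? {240} λ i → Fin.any? λ v → goodAt? x y 5 (m ℕ.* 5) (toℕ i) r v) →
  Base m
base-compute x y m zb g sh gl = record
  { zeroBase   = zb
  -- 48 and 240 are the periods of F modulo 84 and 420, so for `m` dividing 84 the searches cover
  -- full periods.
  ; F-good     = good-compute 0 0 1 m 48 (ℕ.1∣ m) g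
  ; F-liftable = record
    { ρ∣m      = ℕ.n∣m*n m
    ; hasShift = shift-compute x y 5 (m ℕ.* 5) 240 sh
    ; isGood   = good-compute x y 5 (m ℕ.* 5) 240 (ℕ.n∣m*n m) gl
    }
  }

base-1 : Base 1
base-1 = base-compute 1 2 1 (zeroBase-compute 1 _ refl _) _ refl _

base-2 : Base 2
base-2 = base-compute 3 1 2 (zeroBase-compute 2 _ refl _) _ refl _

base-4 : Base 4
base-4 = base-compute 4 3 4 (zeroBase-compute 4 _ refl _) _ refl _

base-6 : Base 6
base-6 = base-compute 1 2 6 (zeroBase-compute 6 _ refl _) _ refl _

base-7 : Base 7
base-7 = base-compute 3 1 7 (zeroBase-compute 7 _ refl _) _ refl _

base-14 : Base 14
base-14 = base-compute 4 3 14 (zeroBase-compute 14 _ refl _) _ refl _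

zeroBase-3 : ZeroBase 3
zeroBase-3 = zeroBase-compute 3 _ refl _

-- 8 is the period modulo 3. Modulo 9, F 8 = 21 ≡ 3 and F 9 = 34 ≡ 1 + 3 · 2, so x = 1 and x + y =
-- 2.
F-liftable-3 : Liftable F 3 3
F-liftable-3 = record
  { ρ∣m      = ℕ.∣-refl
  ; hasShift = shift-compute 1 1 3 3 8 refl
  ; isGood   = good-compute 1 1 3 3 4 ℕ.∣-refl _
  }

-- Taking ρ = 15 permits lifts both by 3 and by 5. The period modulo 15 is 40, with F 40 / 15 ≡ 7
-- and (F 41 - 1) / 15 ≡ 11 modulo 15.
F-liftable-15 : Liftable F 15 15
F-liftable-15 = record
  { ρ∣m      = ℕ.∣-refl
  ; hasShift = shift-compute 7 4 15 15 40 refl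
  ; isGood   = good-compute 7 4 15 15 20 ℕ.∣-refl _
  }

complete-3^ : IsGib s → Primitive (s 0) (s 1) → ∀ j → Complete s (3 ^ suc j)
complete-3^ gs prim j = let n , e = ZeroBase.hasZero zeroBase-3 gs prim in
  liftable⇒complete (lift-^ gs ℕ.∣-refl (ℕ.divides 1 refl) (F-liftable⇒liftable gs prim n e F-liftable-3) j)

complete-3^-5^ : IsGib s → Primitive (s 0) (s 1) → ¬ Δ (s 0) (s 1) ≋ + 0 [ 5 ] →
                 ∀ j k → Complete s (3 ^ suc j ℕ.* 5 ^ k)
complete-3^-5^ gs prim Δ≢0 j zero =
  subst (Complete _) (sym (ℕ.*-identityʳ (3 ^ suc j))) (complete-3^ gs prim j)
complete-3^-5^ gs prim Δ≢0 j (suc k) = let n , e = ZeroBase.hasZero-*5 zeroBase-3 gs prim Δ≢0 in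
  subst (Complete _) (lemma (3 ^ j) (5 ^ k)) (liftable⇒complete
    (lift-^ gs (ℕ.divides 3 refl) (ℕ.divides 2 refl)
      (lift-^ gs (ℕ.divides 5 refl) (ℕ.divides 1 refl) (F-liftable⇒liftable gs prim n e F-liftable-15) j) k))
  where
  lemma : ∀ a b → 15 ℕ.* a ℕ.* b ≡ 3 ℕ.* a ℕ.* (5 ℕ.* b)
  lemma = ℕRing.solve-∀

lucasModuli⇒complete : IsGib s → Primitive (s 0) (s 1) → LucasModuli m → Complete s m
lucasModuli⇒complete gs prim (inj₁ (here refl))                                     = Base.complete base-2 gs prim
lucasModuli⇒complete gs prim (inj₁ (there (here refl)))                             = Base.complete base-4 gs prim
lucasModuli⇒complete gs prim (inj₁ (there (there (here refl))))                     = Base.complete base-6 gs prim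
lucasModuli⇒complete gs prim (inj₁ (there (there (there (here refl)))))             = Base.complete base-7 gs prim
lucasModuli⇒complete gs prim (inj₁ (there (there (there (there (here refl))))))     = Base.complete base-14 gs prim
lucasModuli⇒complete gs prim (inj₂ (suc j , _ , refl))                              = complete-3^ gs prim j

fibonacciModuli⇒complete : IsGib s → Primitive (s 0) (s 1) → ¬ Δ (s 0) (s 1) ≋ + 0 [ 5 ] →
                           FibonacciModuli m → Complete s m
fibonacciModuli⇒complete gs prim Δ≢0 ((k , _ , _ , here refl) , _) =
  subst (Complete _) (ℕ.*-identityˡ (5 ^ k)) (Base.complete-5^ base-1 gs prim Δ≢0 k)
fibonacciModuli⇒complete gs prim Δ≢0 ((k , _ , _ , there (here refl)) , _) =
  Base.complete-5^ base-2 gs prim Δ≢0 k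
fibonacciModuli⇒complete gs prim Δ≢0 ((k , _ , _ , there (there (here refl))) , _) =
  Base.complete-5^ base-4 gs prim Δ≢0 k
fibonacciModuli⇒complete gs prim Δ≢0 ((k , suc j , _ , there (there (there (here refl)))) , _) =
  complete-3^-5^ gs prim Δ≢0 j k
fibonacciModuli⇒complete gs prim Δ≢0 ((k , _ , _ , there (there (there (there (here refl))))) , _) =
  Base.complete-5^ base-6 gs prim Δ≢0 k
fibonacciModuli⇒complete gs prim Δ≢0 ((k , _ , _ , there (there (there (there (there (here refl)))))) , _) =
  Base.complete-5^ base-7 gs prim Δ≢0 k
fibonacciModuli⇒complete gs prim Δ≢0 ((k , _ , _ , there (there (there (there (there (there (here refl))))))) , _) =
  Base.complete-5^ base-14 gs prim Δ≢0 k

-- Prime moduli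

-- `linear` and `linear₂` turn a displayed combination of known congruences into a new one, leaving
-- a polynomial identity to the ring solver.
linear : ∀ c → x ≋ y [ m ] → z - w ≡ c * (x - y) → z ≋ w [ m ]
linear c (mod d) eq = mod (subst (_ ∣_) (sym eq) (∣n⇒∣m*n c d))

linear₂ : ∀ c c′ → x ≋ y [ m ] → x′ ≋ y′ [ m ] → z - w ≡ c * (x - y) + c′ * (x′ - y′) → z ≋ w [ m ]
linear₂ c c′ (mod d) (mod e) eq = mod (subst (_ ∣_) (sym eq) (∣m∣n⇒∣m+n (∣n⇒∣m*n c d) (∣n⇒∣m*n c′ e)))

ℕ∣⇒≋0 : ∀ n → m ℕ.∣ n → + n ≋ + 0 [ m ]
ℕ∣⇒≋0 n d = ∣⇒≋0 (∣ᵤ⇒∣ d)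

≋0⇒ℕ∣ : ∀ n → + n ≋ + 0 [ m ] → m ℕ.∣ n
≋0⇒ℕ∣ n e = ∣⇒∣ᵤ (≋0⇒∣ e)

*-≋0 : ∀ {p} → Prime p → ∀ x y → x * y ≋ + 0 [ p ] → x ≋ + 0 [ p ] ⊎ y ≋ + 0 [ p ]
*-≋0 {p} pr x y e with euclidsLemma ∣ x ∣ ∣ y ∣ pr (subst (p ℕ.∣_) (ℤ.abs-* x y) (∣⇒∣ᵤ (≋0⇒∣ e)))
... | inj₁ d = inj₁ (∣⇒≋0 (∣ᵤ⇒∣ d))
... | inj₂ d = inj₂ (∣⇒≋0 (∣ᵤ⇒∣ d))

*-cancel-≋0 : ∀ {p} → Prime p → ∀ n y → ¬ p ℕ.∣ n → + n * y ≋ + 0 [ p ] → y ≋ + 0 [ p ]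
*-cancel-≋0 pr n y p∤n e with *-≋0 pr (+ n) y e
... | inj₁ d = ⊥-elim (p∤n (≋0⇒ℕ∣ n d))
... | inj₂ d = d

-- Binomial coefficients and the Frobenius congruence

[k+1]*[n+1]C[k+1]≡[n+1]*nCk : ∀ n k → suc k ℕ.* (suc n C suc k) ≡ suc n ℕ.* (n C k)
[k+1]*[n+1]C[k+1]≡[n+1]*nCk zero    zero    = refl
[k+1]*[n+1]C[k+1]≡[n+1]*nCk zero    (suc k) = ℕ.*-zeroʳ (2 ℕ.+ k)
[k+1]*[n+1]C[k+1]≡[n+1]*nCk (suc n) zero    = begin
  1 ℕ.* (suc (suc n) C 1)                       ≡⟨ cong (1 ℕ.*_) (nCk+nC[k+1]≡[n+1]C[k+1] (suc n) 0) ⟨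
  1 ℕ.* (1 ℕ.+ (suc n C 1))                     ≡⟨ lemma (suc n C 1) ⟩
  1 ℕ.+ 1 ℕ.* (suc n C 1)                       ≡⟨ cong suc ([k+1]*[n+1]C[k+1]≡[n+1]*nCk n zero) ⟩
  1 ℕ.+ suc n ℕ.* 1                             ∎
  where
  open ≡-Reasoning
  lemma : ∀ a → 1 ℕ.* (1 ℕ.+ a) ≡ 1 ℕ.+ 1 ℕ.* a
  lemma = ℕRing.solve-∀
[k+1]*[n+1]C[k+1]≡[n+1]*nCk (suc n) (suc k) = begin
  (2 ℕ.+ k) ℕ.* (suc (suc n) C suc (suc k))     ≡⟨ cong ((2 ℕ.+ k) ℕ.*_) (nCk+nC[k+1]≡[n+1]C[k+1] (suc n) (suc k)) ⟨
  (2 ℕ.+ k) ℕ.* (a ℕ.+ (suc n C suc (suc k)))   ≡⟨ lemma₁ k a _ ⟩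
  a ℕ.+ (suc k ℕ.* a ℕ.+ (2 ℕ.+ k) ℕ.* (suc n C suc (suc k)))
    ≡⟨ cong (a ℕ.+_) (cong₂ ℕ._+_ ([k+1]*[n+1]C[k+1]≡[n+1]*nCk n k) ([k+1]*[n+1]C[k+1]≡[n+1]*nCk n (suc k))) ⟩
  a ℕ.+ (suc n ℕ.* (n C k) ℕ.+ suc n ℕ.* (n C suc k))   ≡⟨ cong (a ℕ.+_) (ℕ.*-distribˡ-+ (suc n) (n C k) (n C suc k)) ⟨
  a ℕ.+ suc n ℕ.* ((n C k) ℕ.+ (n C suc k))     ≡⟨ cong (λ t → a ℕ.+ suc n ℕ.* t) (nCk+nC[k+1]≡[n+1]C[k+1] n k) ⟩
  (2 ℕ.+ n) ℕ.* a                               ∎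
  where
  open ≡-Reasoning
  a = suc n C suc k
  lemma₁ : ∀ k a b → (2 ℕ.+ k) ℕ.* (a ℕ.+ b) ≡ a ℕ.+ ((1 ℕ.+ k) ℕ.* a ℕ.+ (2 ℕ.+ k) ℕ.* b)
  lemma₁ = ℕRing.solve-∀

-- By the absorption identity the prime divides k + 1 times the binomial coefficient, and k + 1 is
-- too small to be divisible by it.
prime∣C : ∀ {p} → Prime (suc p) → ∀ k → k < p → suc p ℕ.∣ (suc p C suc k)
prime∣C {p} pr k k<p with euclidsLemma (suc k) (suc p C suc k) pr
  (subst (suc p ℕ.∣_) (sym ([k+1]*[n+1]C[k+1]≡[n+1]*nCk p k)) (ℕ.m∣m*n (p C k)))
... | inj₁ d = ⊥-elim (ℕ.>⇒∤ (s≤s k<p) d)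
... | inj₂ d = d

-- (1 + S)^N = S^(2N) for the shift S; the e extra terms vanish.
binomial-gib : IsGib s → ∀ N e n →
  sum {suc (N ℕ.+ e)} (λ k → + (N C toℕ k) * s (toℕ k ℕ.+ n)) ≡ s (N ℕ.+ N ℕ.+ n)
binomial-gib {s} gs zero e n =
  trans (cong₂ _+_ (ℤ.*-identityˡ (s n)) (sum-replicate-zero e)) (ℤ.+-identityʳ (s n))
binomial-gib {s} gs (suc N) e n = begin
  c + sum tail                          ≡⟨ cong (λ t → c + t) (trans (sum-cong-≗ pascal) (∑-distrib-+ left right)) ⟩
  c + (sum left + sum right)            ≡⟨ lemma c (sum left) (sum right) ⟩
  (c + sum right) + sum left            ≡⟨ cong₂ _+_ IH₀ (binomial-gib gs N e (suc n)) ⟩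
  s (N ℕ.+ N ℕ.+ n) + s (N ℕ.+ N ℕ.+ suc n)   ≡⟨ cong (λ i → s (N ℕ.+ N ℕ.+ n) + s i) (ℕ.+-suc (N ℕ.+ N) n) ⟩
  s (N ℕ.+ N ℕ.+ n) + s (suc (N ℕ.+ N ℕ.+ n)) ≡⟨ recurrence gs (N ℕ.+ N ℕ.+ n) ⟨
  s (2 ℕ.+ (N ℕ.+ N ℕ.+ n))             ≡⟨ cong (λ i → s (suc (i ℕ.+ n))) (ℕ.+-suc N N) ⟨
  s (suc N ℕ.+ suc N ℕ.+ n)             ∎
  where
  open ≡-Reasoning
  c = + 1 * s n
  tail left right : Fin (suc (N ℕ.+ e)) → ℤ
  tail k  = + (suc N C suc (toℕ k)) * s (suc (toℕ k) ℕ.+ n)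
  left k  = + (N C toℕ k) * s (toℕ k ℕ.+ suc n)
  right k = + (N C suc (toℕ k)) * s (suc (toℕ k) ℕ.+ n)
  pascal : ∀ k → tail k ≡ left k + right k
  pascal k = begin
    + (suc N C suc (toℕ k)) * a                    ≡⟨ cong (λ t → + t * a) (nCk+nC[k+1]≡[n+1]C[k+1] N (toℕ k)) ⟨
    (+ (N C toℕ k) + + (N C suc (toℕ k))) * a      ≡⟨ ℤ.*-distribʳ-+ a (+ (N C toℕ k)) (+ (N C suc (toℕ k))) ⟩
    + (N C toℕ k) * a + right k                    ≡⟨ cong (λ i → + (N C toℕ k) * s i + right k) (ℕ.+-suc (toℕ k) n) ⟨
    left k + right k                               ∎
    where a = s (suc (toℕ k) ℕ.+ n)
  -- The leading term and the right halves form the sum for `N` at `n` with one more vanishing term;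
  -- this is why the padding `e` is carried.
  IH₀ : c + sum right ≡ s (N ℕ.+ N ℕ.+ n)
  IH₀ = subst (λ K → sum {suc K} (λ k → + (N C toℕ k) * s (toℕ k ℕ.+ n)) ≡ s (N ℕ.+ N ℕ.+ n))
    (ℕ.+-suc N e) (binomial-gib gs N (suc e) n)
  lemma : ∀ a b c → a + (b + c) ≡ (a + c) + b
  lemma = solve-∀

sum-last : ∀ n (f : ℕ → ℤ) → (∀ k → k < n → f k ≋ + 0 [ m ]) → sum {suc n} (f ∘ toℕ) ≋ f n [ m ]
sum-last zero f z = mod-reflexive (ℤ.+-identityʳ (f 0))
sum-last {m} (suc n) f z = begin
  f 0 + sum {suc n} (λ k → f (suc (toℕ k)))  ≈⟨ mod-+ (z 0 (s≤s z≤n)) (sum-last n (f ∘ suc) λ k k<n → z (suc k) (s≤s k<n)) ⟩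
  + 0 + f (suc n)                            ≡⟨ ℤ.+-identityˡ (f (suc n)) ⟩
  f (suc n)                                  ∎
  where open mod-Reasoning m

frobenius : ∀ {p} → Prime p → IsGib s → ∀ n → s (p ℕ.+ p ℕ.+ n) ≋ s n + s (p ℕ.+ n) [ p ]
frobenius {p = zero} pr = ⊥-elim (ℕ.≢-nonZero⁻¹ 0 {{prime⇒nonZero pr}} refl)
frobenius {s} {p@(suc p′)} pr gs n = begin
  s (p ℕ.+ p ℕ.+ n)                                ≡⟨ subst (λ K → sum {suc K} (f ∘ toℕ) ≡ s (p ℕ.+ p ℕ.+ n)) (ℕ.+-identityʳ p) (binomial-gib gs p 0 n) ⟨
  + 1 * s n + sum {suc p′} (f ∘ suc ∘ toℕ)         ≈⟨ mod-+ˡ (+ 1 * s n) (sum-last p′ (f ∘ suc) middle) ⟩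
  + 1 * s n + + (p C p) * s (p ℕ.+ n)              ≡⟨ cong₂ _+_ (ℤ.*-identityˡ (s n)) (trans (cong (λ t → + t * s (p ℕ.+ n)) (nCn≡1 p)) (ℤ.*-identityˡ _)) ⟩
  s n + s (p ℕ.+ n)                                ∎
  where
  open mod-Reasoning p
  f : ℕ → ℤ
  f k = + (p C k) * s (k ℕ.+ n)
  middle : ∀ k → k < p′ → f (suc k) ≋ + 0 [ p ]
  middle k k<p′ = begin
    + (p C suc k) * s (suc k ℕ.+ n)  ≈⟨ mod-*ʳ (s (suc k ℕ.+ n)) (ℕ∣⇒≋0 (p C suc k) (prime∣C pr k k<p′)) ⟩
    + 0 * s (suc k ℕ.+ n)            ≡⟨⟩
    + 0                              ∎

-- Cassini's identity with its alternating sign squared away.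
Δ²-F : ∀ n → Δ (F n) (F (suc n)) * Δ (F n) (F (suc n)) ≡ + 1
Δ²-F zero    = refl
Δ²-F (suc n) = begin
  Δ (F (suc n)) (F (2 ℕ.+ n)) * Δ (F (suc n)) (F (2 ℕ.+ n))  ≡⟨ cong₂ _*_ step step ⟩
  - Δ (F n) (F (suc n)) * - Δ (F n) (F (suc n))              ≡⟨ lemma (Δ (F n) (F (suc n))) ⟩
  Δ (F n) (F (suc n)) * Δ (F n) (F (suc n))                  ≡⟨ Δ²-F n ⟩
  + 1                                                        ∎
  where
  open ≡-Reasoning
  step = Δ-step (G-isGib (+ 0) (+ 1)) n
  lemma : ∀ a → - a * - a ≡ a * a
  lemma = solve-∀

module _ {p : ℕ} (pr : Prime p) (p∤210 : ¬ p ℕ.∣ 210) where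

  private
    ∤ : ∀ n → n ℕ.∣ 210 → ¬ p ℕ.∣ n
    ∤ n n∣210 p∣n = p∤210 (ℕ.∣-trans p∣n n∣210)

    -- `a` and `b` stand for `F p` and `F (suc p)`; `e₀` and `e₁` are the Frobenius congruences at 0
    -- and 1 after the doubling formulas.
    module _ (a b : ℤ) (Δ²≡1 : Δ a b * Δ a b ≡ + 1) (e₀ : a * (+ 2 * b - a) ≋ a [ p ])
             (e₁ : a * a + b * b ≋ + 1 + b [ p ]) where

      factored : a * (+ 2 * b - a - + 1) ≋ + 0 [ p ]
      factored = linear (+ 1) e₀ (lemma a b)
        where
        lemma : ∀ a b → a * (+ 2 * b - a - + 1) - + 0 ≡ + 1 * (a * (+ 2 * b - a) - a)
        lemma = solve-∀

      a≢0 : ¬ a ≋ + 0 [ p ]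
      -- The Euclidean algorithm on b⁴ − 1 and b² − b − 1 ends in 5.
      a≢0 a≋0 = ∤ 5 (ℕ.divides 42 refl) (≋0⇒ℕ∣ 5 (linear₂
        (+ 3 * b - + 4) (- ((+ 3 * b - + 4) * (b * b + b + + 2) + + 9)) b⁴≋1 b²≋1+b (lemma₃ b)))
        where
        lemma₁ : ∀ a b → b * b - (+ 1 + b) ≡ + 1 * (a * a + b * b - (+ 1 + b)) + - a * (a - + 0)
        lemma₁ = solve-∀
        b²≋1+b : b * b ≋ + 1 + b [ p ]
        b²≋1+b = linear₂ (+ 1) (- a) e₁ a≋0 (lemma₁ a b)
        lemma₂ : ∀ a b → b * b * (b * b) - (a * a + a * b - b * b) * (a * a + a * b - b * b) ≡
                 ((b * b - (a * a + a * b - b * b)) * (a + b)) * (a - + 0)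
        lemma₂ = solve-∀
        b⁴≋1 : b * b * (b * b) ≋ + 1 [ p ]
        b⁴≋1 = linear ((b * b - Δ a b) * (a + b)) a≋0
          (trans (cong (λ t → b * b * (b * b) - t) (sym Δ²≡1)) (lemma₂ a b))
        lemma₃ : ∀ b → + 5 - + 0 ≡ (+ 3 * b - + 4) * (b * b * (b * b) - + 1) +
                 - ((+ 3 * b - + 4) * (b * b + b + + 2) + + 9) * (b * b - (+ 1 + b))
        lemma₃ = solve-∀

      -- Substituting 2b ≡ a + 1 into four times `e₁` leaves 5 (a² - 1) ≡ 0.
      a≋±1 : + 2 * b - a - + 1 ≋ + 0 [ p ] → a - + 1 ≋ + 0 [ p ] ⊎ a + + 1 ≋ + 0 [ p ]
      a≋±1 e = *-≋0 pr (a - + 1) (a + + 1) (*-cancel-≋0 pr 5 ((a - + 1) * (a + + 1)) (∤ 5 (ℕ.divides 42 refl))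
        (linear₂ (+ 4) (- (a + + 2 * b - + 1)) e₁ e (lemma a b)))
        where
        lemma : ∀ a b → + 5 * ((a - + 1) * (a + + 1)) - + 0 ≡
                + 4 * (a * a + b * b - (+ 1 + b)) + - (a + + 2 * b - + 1) * (+ 2 * b - a - + 1 - + 0)
        lemma = solve-∀

      Solutions : Set
      Solutions = (a ≋ + 1 [ p ] × b ≋ + 1 [ p ]) ⊎ (a ≋ - + 1 [ p ] × b ≋ + 0 [ p ])

      solution⁺ : + 2 * b - a - + 1 ≋ + 0 [ p ] → a - + 1 ≋ + 0 [ p ] → Solutions
      solution⁺ e d = inj₁ (linear (+ 1) d (lemma₁ a) , linear (+ 1) b-1≋0 (lemma₁ b))
        where
        lemma₁ : ∀ a → a - + 1 ≡ + 1 * (a - + 1 - + 0)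
        lemma₁ = solve-∀
        lemma₂ : ∀ a b → + 2 * (b - + 1) - + 0 ≡ + 1 * (+ 2 * b - a - + 1 - + 0) + + 1 * (a - + 1 - + 0)
        lemma₂ = solve-∀
        b-1≋0 : b - + 1 ≋ + 0 [ p ]
        b-1≋0 = *-cancel-≋0 pr 2 (b - + 1) (∤ 2 (ℕ.divides 105 refl)) (linear₂ (+ 1) (+ 1) e d (lemma₂ a b))

      solution⁻ : + 2 * b - a - + 1 ≋ + 0 [ p ] → a + + 1 ≋ + 0 [ p ] → Solutions
      solution⁻ e d = inj₂ (linear (+ 1) d (lemma₁ a) ,
        *-cancel-≋0 pr 2 b (∤ 2 (ℕ.divides 105 refl)) (linear₂ (+ 1) (+ 1) e d (lemma₂ a b)))
        where
        lemma₁ : ∀ a → a - - + 1 ≡ + 1 * (a + + 1 - + 0)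
        lemma₁ = solve-∀
        lemma₂ : ∀ a b → + 2 * b - + 0 ≡ + 1 * (+ 2 * b - a - + 1 - + 0) + + 1 * (a + + 1 - + 0)
        lemma₂ = solve-∀

      solutions : Solutions
      solutions = [ (λ a≋0 → ⊥-elim (a≢0 a≋0)) , (λ e → [ solution⁺ e , solution⁻ e ]′ (a≋±1 e)) ]′
        (*-≋0 pr a (+ 2 * b - a - + 1) factored)

  F-at-prime : (F p ≋ + 1 [ p ] × F (suc p) ≋ + 1 [ p ]) ⊎ (F p ≋ - + 1 [ p ] × F (suc p) ≋ + 0 [ p ])
  F-at-prime = solutions (F p) (F (suc p)) (Δ²-F p)
    (begin
      F p * (+ 2 * F (suc p) - F p)  ≡⟨ F-2n p ⟨
      F (p ℕ.+ p)                    ≡⟨ cong F (ℕ.+-identityʳ (p ℕ.+ p)) ⟨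
      F (p ℕ.+ p ℕ.+ 0)              ≈⟨ frobenius pr (G-isGib (+ 0) (+ 1)) 0 ⟩
      + 0 + F (p ℕ.+ 0)              ≡⟨ ℤ.+-identityˡ (F (p ℕ.+ 0)) ⟩
      F (p ℕ.+ 0)                    ≡⟨ cong F (ℕ.+-identityʳ p) ⟩
      F p                            ∎)
    (begin
      F p * F p + F (suc p) * F (suc p)  ≡⟨ F-2n+1 p ⟨
      F (suc (p ℕ.+ p))                  ≡⟨ cong F (ℕ.+-comm (p ℕ.+ p) 1) ⟨
      F (p ℕ.+ p ℕ.+ 1)                  ≈⟨ frobenius pr (G-isGib (+ 0) (+ 1)) 1 ⟩
      + 1 + F (p ℕ.+ 1)                  ≡⟨ cong (λ i → + 1 + F i) (ℕ.+-comm p 1) ⟩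
      + 1 + F (suc p)                    ∎)
    where open mod-Reasoning p

-- Residues within a period, permutations and sums of squares

≋⇒≡ : ∀ {a b} → a < m → b < m → + a ≋ + b [ m ] → a ≡ b
≋⇒≡ {m} {a} {b} a<m b<m (mod d) with ∣ + a - + b ∣ in eq | ∣⇒∣ᵤ d
... | zero  | _   = ℤ.+-injective (ℤ.i-j≡0⇒i≡j (+ a) (+ b) (ℤ.∣i∣≡0⇒i≡0 eq))
... | suc k | m∣k = ⊥-elim (ℕ.>⇒∤ (begin-strict
  suc k             ≡⟨ eq ⟨
  ∣ + a - + b ∣     ≡⟨ cong ∣_∣ (ℤ.[+m]-[+n]≡m⊖n a b) ⟩
  ∣ a ⊖ b ∣         ≤⟨ ℤ.∣m⊝n∣≤m⊔n a b ⟩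
  a ℕ.⊔ b           <⟨ ℕ.⊔-lub a<m b<m ⟩
  m                 ∎) m∣k)
  where open ℕ.≤-Reasoning

period-% : ∀ {π} .{{_ : ℕ.NonZero π}} → Period m π → IsGib s → ∀ n → s n ≋ s (n % π) [ m ]
period-% {m} {s} {π} per gs n = begin
  s n                            ≡⟨ cong s (trans (ℕ.m≡m%n+[m/n]*n n π) (ℕ.+-comm (n % π) (n / π ℕ.* π))) ⟩
  s (n / π ℕ.* π ℕ.+ n % π)      ≈⟨ period-* per (n / π) gs (n % π) ⟩
  s (n % π)                      ∎
  where open mod-Reasoning m

-- Choosing for each residue an index below `π` gives an injection from `Fin m` to `Fin π`.
complete⇒≤period : ∀ {π} .{{_ : ℕ.NonZero π}} → Period m π → IsGib s → Complete s m → m ≤ π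
complete⇒≤period {m} {s} {π} per gs comp = Fin.injective⇒≤ {f = index} index-injective
  where
  index : Fin m → Fin π
  index r = fromℕ< (ℕ.m%n<n (proj₁ (comp (+ toℕ r))) π)
  value : ∀ r → s (toℕ (index r)) ≋ + toℕ r [ m ]
  value r = begin
    s (toℕ (index r))   ≡⟨ cong s (Fin.toℕ-fromℕ< _) ⟩
    s (n % π)           ≈⟨ period-% per gs n ⟨
    s n                 ≈⟨ proj₂ (comp (+ toℕ r)) ⟩
    + toℕ r             ∎
    where
    open mod-Reasoning m
    n = proj₁ (comp (+ toℕ r))
  index-injective : Injective _≡_ _≡_ index
  index-injective {r} {r′} eq = Fin.toℕ-injective (≋⇒≡ (Fin.toℕ<n r) (Fin.toℕ<n r′)
    (mod-trans (mod-sym (value r)) (mod-trans (mod-reflexive (cong (s ∘ toℕ) eq)) (value r′))))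

-- A missed value `j` could be punched out, giving an injection into a smaller finite set.
injective⇒surjective : ∀ {n} {f : Fin n → Fin n} → Injective _≡_ _≡_ f → ∀ j → ∃[ i ] f i ≡ j
injective⇒surjective {suc n} {f} inj j with Fin.any? (λ i → f i Fin.≟ j)
... | yes found = found
... | no  ¬found = ⊥-elim (ℕ.1+n≰n (Fin.injective⇒≤ {f = λ i → punchOut (j≢f i)}
  (λ {i} {i′} eq → inj (Fin.punchOut-injective (j≢f i) (j≢f i′) eq))))
  where
  j≢f : ∀ i → j ≢ f i
  j≢f i eq = ¬found (i , sym eq)

injective⇒permutation : ∀ {n} (f : Fin n → Fin n) → Injective _≡_ _≡_ f → Permutation n n
injective⇒permutation f inj = permutation f (λ j → proj₁ (surj j)) (λ j → proj₂ (surj j))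
  (λ i → inj (proj₂ (surj (f i))))
  where surj = injective⇒surjective inj

sum-reindex : ∀ {n} (g : Fin n → ℤ) (f : Fin n → Fin n) → Injective _≡_ _≡_ f → sum g ≡ sum (g ∘ f)
sum-reindex g f inj = sum-permute g (injective⇒permutation f inj)

sum-mod : ∀ {n} {f g : Fin n → ℤ} → (∀ i → f i ≋ g i [ m ]) → sum f ≋ sum g [ m ]
sum-mod {n = zero}  e = mod-refl
sum-mod {n = suc n} e = mod-+ (e zero) (sum-mod (e ∘ suc))

-- Telescoping of s_i² = s_i s_{i+1} - s_{i-1} s_i. The sum unfolds at its first term, so the
-- induction hypothesis is applied to the shifted sequence.
sum-gib² : IsGib s → ∀ k → sum {k} (λ i → s (suc (toℕ i)) * s (suc (toℕ i))) ≡ s k * s (suc k) - s 0 * s 1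
sum-gib² {s} gs zero = sym (ℤ.+-inverseʳ (s 0 * s 1))
sum-gib² {s} gs (suc k) = begin
  s 1 * s 1 + sum {k} (λ i → s (2 ℕ.+ toℕ i) * s (2 ℕ.+ toℕ i))
    ≡⟨ cong (λ t → s 1 * s 1 + t) (sum-gib² {s ∘ suc} (gib (recurrence gs ∘ suc)) k) ⟩
  s 1 * s 1 + (c - s 1 * s 2)           ≡⟨ cong (λ t → s 1 * s 1 + (c - s 1 * t)) (recurrence gs 0) ⟩
  s 1 * s 1 + (c - s 1 * (s 0 + s 1))   ≡⟨ lemma (s 0) (s 1) c ⟩
  c - s 0 * s 1                         ∎
  where
  open ≡-Reasoning
  c = s (suc k) * s (2 ℕ.+ k)
  lemma : ∀ a b c → b * b + (c - b * (a + b)) ≡ c - a * b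
  lemma = solve-∀

-- The offset `a` lets the induction peel off the first term; at `a` = 0 the right side is n(n -
-- 1)(2n - 1).
sum-squares : ∀ n (a : ℤ) → + 6 * sum {n} (λ i → (a + + toℕ i) * (a + + toℕ i)) ≡
              + n * (+ 6 * a * a + + 6 * a * (+ n - + 1) + (+ n - + 1) * (+ 2 * + n - + 1))
sum-squares zero    a = refl
sum-squares (suc n) a = begin
  + 6 * ((a + + 0) * (a + + 0) + sum {n} (λ i → (a + + suc (toℕ i)) * (a + + suc (toℕ i))))
    ≡⟨ cong (λ t → + 6 * ((a + + 0) * (a + + 0) + t)) (sum-cong-≗ {n} λ i → cong₂ _*_ (assoc i) (assoc i)) ⟩
  + 6 * ((a + + 0) * (a + + 0) + S)       ≡⟨ lemma₁ a S ⟩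
  + 6 * a * a + + 6 * S                   ≡⟨ cong (λ t → + 6 * a * a + t) (sum-squares n (a + + 1)) ⟩
  + 6 * a * a + + n * (+ 6 * (a + + 1) * (a + + 1) + + 6 * (a + + 1) * (+ n - + 1) + (+ n - + 1) * (+ 2 * + n - + 1))
    ≡⟨ lemma₂ (+ n) a ⟩
  (+ 1 + + n) * (+ 6 * a * a + + 6 * a * ((+ 1 + + n) - + 1) + ((+ 1 + + n) - + 1) * (+ 2 * (+ 1 + + n) - + 1)) ∎
  where
  open ≡-Reasoning
  S = sum {n} (λ i → (a + + 1 + + toℕ i) * (a + + 1 + + toℕ i))
  assoc : ∀ (i : Fin n) → a + + suc (toℕ i) ≡ a + + 1 + + toℕ i
  assoc i = sym (ℤ.+-assoc a (+ 1) (+ toℕ i))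
  lemma₁ : ∀ a S → + 6 * ((a + + 0) * (a + + 0) + S) ≡ + 6 * a * a + + 6 * S
  lemma₁ = solve-∀
  lemma₂ : ∀ n a → + 6 * a * a + n * (+ 6 * (a + + 1) * (a + + 1) + + 6 * (a + + 1) * (n - + 1) + (n - + 1) * (+ 2 * n - + 1)) ≡
           (+ 1 + n) * (+ 6 * a * a + + 6 * a * ((+ 1 + n) - + 1) + ((+ 1 + n) - + 1) * (+ 2 * (+ 1 + n) - + 1))
  lemma₂ = solve-∀

-- Squares of Fibonacci numbers along an antiperiod

sq : ℤ → ℤ
sq x = x * x

module _ {m h : ℕ} (F2h : F (h ℕ.+ h) ≋ + 0 [ m ]) (F2h+1 : F (suc (h ℕ.+ h)) ≋ - + 1 [ m ]) where

  antiperiod : IsGib s → ∀ n → s (h ℕ.+ h ℕ.+ n) ≋ - s n [ m ]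
  antiperiod {s} gs n = begin
    s (h ℕ.+ h ℕ.+ n)     ≡⟨ gib-+ gs (h ℕ.+ h) n ⟩
    F (h ℕ.+ h) * s (suc n) + (F (suc (h ℕ.+ h)) - F (h ℕ.+ h)) * s n
                          ≈⟨ mod-+ (mod-*ʳ (s (suc n)) F2h) (mod-*ʳ (s n) (mod-- F2h+1 F2h)) ⟩
    + 0 * s (suc n) + (- + 1 - + 0) * s n  ≡⟨ lemma (s n) (s (suc n)) ⟩
    - s n                 ∎
    where
    open mod-Reasoning m
    lemma : ∀ a b → + 0 * b + (- + 1 - + 0) * a ≡ - a
    lemma = solve-∀

  sq-antiperiod : IsGib s → ∀ j n → sq (s (j ℕ.* (h ℕ.+ h) ℕ.+ n)) ≋ sq (s n) [ m ]
  sq-antiperiod gs zero n = mod-refl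
  sq-antiperiod {s} gs (suc j) n = begin
    sq (s (h ℕ.+ h ℕ.+ j ℕ.* (h ℕ.+ h) ℕ.+ n))   ≡⟨ cong (sq ∘ s) (ℕ.+-assoc (h ℕ.+ h) (j ℕ.* (h ℕ.+ h)) n) ⟩
    sq (s (h ℕ.+ h ℕ.+ i))                       ≈⟨ mod-* (antiperiod gs i) (antiperiod gs i) ⟩
    - s i * - s i                                ≡⟨ lemma (s i) ⟩
    sq (s i)                                     ≈⟨ sq-antiperiod gs j n ⟩
    sq (s n)                                     ∎
    where
    open mod-Reasoning m
    i = j ℕ.* (h ℕ.+ h) ℕ.+ n
    lemma : ∀ a → - a * - a ≡ a * a
    lemma = solve-∀

  -- Here ε = (-1)^j, found by running the recurrence down from 2h; the second congruence carries
  -- F_{j-1}, written `F (suc j) - F j`. Recording ε² = 1 suffices for squares.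
  reflection : ∀ j i → i ℕ.+ j ≡ h ℕ.+ h →
    ∃[ ε ] ε * ε ≡ + 1 × F i ≋ ε * F j [ m ] × F (suc i) ≋ - ε * (F (suc j) - F j) [ m ]
  reflection zero i eq = + 1 , refl , subst (λ i → F i ≋ + 0 [ m ]) (sym i≡2h) F2h ,
                         subst (λ i → F (suc i) ≋ - + 1 [ m ]) (sym i≡2h) F2h+1
    where
    i≡2h : i ≡ h ℕ.+ h
    i≡2h = trans (sym (ℕ.+-identityʳ i)) eq
  reflection (suc j) i eq with reflection j (suc i) (trans (sym (ℕ.+-suc i j)) eq)
  ... | ε , ε²≡1 , e₀ , e₁ = - ε , trans (lemma₁ ε) ε²≡1 ,
    linear₂ (+ 1) (- + 1) e₁ e₀ (lemma₂ (F i) (F (suc i)) ε (F j) (F (suc j))) ,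
    linear (+ 1) e₀ (lemma₃ (F (suc i)) ε (F j) (F (suc j)))
    where
    lemma₁ : ∀ ε → - ε * - ε ≡ ε * ε
    lemma₁ = solve-∀
    lemma₂ : ∀ a b ε c d → a - - ε * d ≡ + 1 * ((a + b) - - ε * (d - c)) + - + 1 * (b - ε * c)
    lemma₂ = solve-∀
    lemma₃ : ∀ b ε c d → b - - - ε * ((c + d) - d) ≡ + 1 * (b - ε * c)
    lemma₃ = solve-∀

  sq-reflection : ∀ j i → i ℕ.+ j ≡ h ℕ.+ h → sq (F i) ≋ sq (F j) [ m ]
  sq-reflection j i eq with reflection j i eq
  ... | ε , ε²≡1 , e , _ = begin
    F i * F i                  ≈⟨ mod-* e e ⟩
    ε * F j * (ε * F j)        ≡⟨ lemma ε (F j) ⟩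
    ε * ε * (F j * F j)        ≡⟨ cong (_* (F j * F j)) ε²≡1 ⟩
    + 1 * (F j * F j)          ≡⟨ ℤ.*-identityˡ _ ⟩
    F j * F j                  ∎
    where
    open mod-Reasoning m
    lemma : ∀ ε a → ε * a * (ε * a) ≡ ε * ε * (a * a)
    lemma = solve-∀

  -- Modulo the antiperiod the index drops below 2h; the reflection of j to 2h - j then folds the
  -- upper half onto the lower.
  sq-reduce : .{{_ : ℕ.NonZero (h ℕ.+ h)}} → ∀ n → ∃[ j ] j ≤ h × sq (F n) ≋ sq (F j) [ m ]
  sq-reduce n = go (j ℕ.≤? h)
    where
    j = n % (h ℕ.+ h)
    j<2h : j < h ℕ.+ h
    j<2h = ℕ.m%n<n n (h ℕ.+ h)
    n≋j : sq (F n) ≋ sq (F j) [ m ]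
    n≋j = mod-trans (mod-reflexive (cong (sq ∘ F)
      (trans (ℕ.m≡m%n+[m/n]*n n (h ℕ.+ h)) (ℕ.+-comm j (n / (h ℕ.+ h) ℕ.* (h ℕ.+ h))))))
      (sq-antiperiod (G-isGib (+ 0) (+ 1)) (n / (h ℕ.+ h)) j)
    go : Dec (j ≤ h) → ∃[ j ] j ≤ h × sq (F n) ≋ sq (F j) [ m ]
    go (yes j≤h) = j , j≤h , n≋j
    go (no  j≰h) = h ℕ.+ h ℕ.∸ j ,
      ℕ.≤-trans (ℕ.∸-monoʳ-≤ (h ℕ.+ h) (ℕ.<⇒≤ (ℕ.≰⇒> j≰h))) (ℕ.≤-reflexive (ℕ.m+n∸n≡m h h)) ,
      mod-trans n≋j (mod-sym (sq-reflection j (h ℕ.+ h ℕ.∸ j) (ℕ.m∸n+n≡m (ℕ.<⇒≤ j<2h))))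

-- F 1 = F 2, so the squares of F 0, …, F h already occur among those at these h indices.
index : ∀ {h} → Fin h → ℕ
index zero    = 0
index (suc i) = 2 ℕ.+ toℕ i

index-covers : ∀ {k} j → j ≤ 2 ℕ.+ k → ∃[ i ] F (index {2 ℕ.+ k} i) ≡ F j
index-covers zero          _               = zero , refl
index-covers (suc zero)    _               = suc zero , refl
index-covers (suc (suc t)) (s≤s (s≤s t≤k)) = suc (fromℕ< (s≤s t≤k)) , cong (λ i → F (2 ℕ.+ i)) (Fin.toℕ-fromℕ< (s≤s t≤k))

-- Index 0 contributes 0; the rest telescopes for `F ∘ suc`, whose initial product F 1 · F 2 is the
-- subtracted 1.
sum-sq-F : ∀ k → sum {suc k} (sq ∘ F ∘ index) ≡ F (suc k) * F (2 ℕ.+ k) - + 1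
sum-sq-F k = trans (ℤ.+-identityˡ _) (sum-gib² {F ∘ suc} (gib λ _ → refl) k)

-- The odd prime is written 2(k + 1) + 1, so that h = (p + 1)/2 is `2 + k`, the form that
-- `index-covers` requires.
module _ {k : ℕ} (pr : Prime (suc (suc k ℕ.+ suc k))) (p∤210 : ¬ suc (suc k ℕ.+ suc k) ℕ.∣ 210)
         (Fp : F (suc (suc k ℕ.+ suc k)) ≋ - + 1 [ suc (suc k ℕ.+ suc k) ])
         (Fp+1 : F (2 ℕ.+ (suc k ℕ.+ suc k)) ≋ + 0 [ suc (suc k ℕ.+ suc k) ])
         (comp : Complete F (suc (suc k ℕ.+ suc k))) where

  private
    h p : ℕ
    h = 2 ℕ.+ k
    p = suc (suc k ℕ.+ suc k)

    2h≡1+p : h ℕ.+ h ≡ suc p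
    2h≡1+p = cong suc (ℕ.+-suc (suc k) (suc k))

    F2h : F (h ℕ.+ h) ≋ + 0 [ p ]
    F2h = subst (λ i → F i ≋ + 0 [ p ]) (sym 2h≡1+p) Fp+1

    F2h+1 : F (suc (h ℕ.+ h)) ≋ - + 1 [ p ]
    F2h+1 = subst (λ i → F (suc i) ≋ - + 1 [ p ]) (sym 2h≡1+p) (mod-+ Fp Fp+1)

    -- By completeness `r` is some F n modulo p, and the square of F n recurs among the `h` chosen
    -- indices.
    cover : ∀ r → ∃[ i ] sq (F (index {h} i)) ≋ sq r [ p ]
    cover r =
      let n , e = comp r
          j , j≤h , e′ = sq-reduce F2h F2h+1 n
          i , eq = index-covers j j≤h
      in i , mod-trans (mod-reflexive (cong sq eq)) (mod-trans (mod-sym e′) (mod-* e e))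

    c : Fin h → Fin h
    c r = proj₁ (cover (+ toℕ r))

    h≤p : h ≤ p
    h≤p = s≤s (s≤s (ℕ.m≤m+n k (suc k)))

    sum<p : ∀ (r r′ : Fin h) → toℕ r ℕ.+ toℕ r′ < p
    sum<p r r′ = s≤s (ℕ.+-mono-≤ (ℕ.s≤s⁻¹ (Fin.toℕ<n r)) (ℕ.s≤s⁻¹ (Fin.toℕ<n r′)))

    -- Equal squares make p divide r - r′ or r + r′. The sum is at most 2(h - 1) = p - 1, so in the
    -- second case both vanish.
    c-injective : Injective _≡_ _≡_ c
    c-injective {r} {r′} eq = Fin.toℕ-injective ([ minus , plus ]′ (*-≋0 pr (+ toℕ r - + toℕ r′) (+ toℕ r + + toℕ r′)
      (linear (+ 1) squares (lemma (+ toℕ r) (+ toℕ r′)))))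
      where
      squares : sq (+ toℕ r) ≋ sq (+ toℕ r′) [ p ]
      squares = mod-trans (mod-sym (proj₂ (cover (+ toℕ r))))
        (mod-trans (mod-reflexive (cong (sq ∘ F ∘ index) eq)) (proj₂ (cover (+ toℕ r′))))
      lemma : ∀ a b → (a - b) * (a + b) - + 0 ≡ + 1 * (a * a - b * b)
      lemma = solve-∀
      lemma′ : ∀ a b → a - b ≡ + 1 * (a - b - + 0)
      lemma′ = solve-∀
      minus : + toℕ r - + toℕ r′ ≋ + 0 [ p ] → toℕ r ≡ toℕ r′
      minus e = ≋⇒≡ (ℕ.<-≤-trans (Fin.toℕ<n r) h≤p) (ℕ.<-≤-trans (Fin.toℕ<n r′) h≤p)
        (linear (+ 1) e (lemma′ (+ toℕ r) (+ toℕ r′)))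
      plus : + (toℕ r ℕ.+ toℕ r′) ≋ + 0 [ p ] → toℕ r ≡ toℕ r′
      plus e = trans (ℕ.m+n≡0⇒m≡0 (toℕ r) r+r′≡0) (sym (ℕ.m+n≡0⇒n≡0 (toℕ r) r+r′≡0))
        where
        r+r′≡0 : toℕ r ℕ.+ toℕ r′ ≡ 0
        r+r′≡0 = ≋⇒≡ (sum<p r r′) (s≤s z≤n) e

    a b : ℤ
    a = F h
    b = F (suc h)

    6[ab-1]≋0 : + 6 * (a * b - + 1) ≋ + 0 [ p ]
    6[ab-1]≋0 = begin
      + 6 * (a * b - + 1)                              ≡⟨ cong (λ t → + 6 * t) (sum-sq-F (suc k)) ⟨
      + 6 * sum f                                      ≡⟨ cong (λ t → + 6 * t) (sum-reindex f c c-injective) ⟩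
      + 6 * sum (f ∘ c)                                ≈⟨ mod-*ˡ (+ 6) (sum-mod {f = f ∘ c} {g = sq ∘ +_ ∘ toℕ} λ r → proj₂ (cover (+ toℕ r))) ⟩
      + 6 * sum {h} (λ r → sq (+ toℕ r))               ≡⟨ cong (λ t → + 6 * t) (sum-cong-≗ {h} λ r → cong sq (ℤ.+-identityˡ (+ toℕ r))) ⟨
      + 6 * sum {h} (λ r → sq (+ 0 + + toℕ r))         ≡⟨ sum-squares h (+ 0) ⟩
      -- This is h(h - 1)(2h - 1), and 2h - 1 = p.
      + h * (+ 0 + + 0 * (+ h - + 1) + (+ h - + 1) * (+ 2 * + h - + 1)) ≡⟨ lemma (+ k) ⟩
      + p * ((+ 1 + + k) * (+ 2 + + k))                ≈⟨ self≋0 p ((+ 1 + + k) * (+ 2 + + k)) ⟩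
      + 0                                              ∎
      where
      open mod-Reasoning p
      f : Fin h → ℤ
      f i = sq (F (index i))
      lemma : ∀ k → (+ 2 + k) * (+ 0 + + 0 * ((+ 2 + k) - + 1) + ((+ 2 + k) - + 1) * (+ 2 * (+ 2 + k) - + 1)) ≡
              (+ 1 + (+ 1 + k + (+ 1 + k))) * ((+ 1 + k) * (+ 2 + k))
      lemma = solve-∀

    -- The first two congruences give ab ≡ 1 and a² ≡ 2ab ≡ 2, the third then b² ≡ -3, so that 1 ≡
    -- a²b² ≡ -6.
    p∣7 : ∀ a b → a * b - + 1 ≋ + 0 [ p ] → a * (+ 2 * b - a) ≋ + 0 [ p ] → a * a + b * b ≋ - + 1 [ p ] → p ℕ.∣ 7
    p∣7 a b e₁ e₂ e₃ = ≋0⇒ℕ∣ 7 (linear₂ (a * a) (+ 1) e₃ rest (lemma₂ a b))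
      where
      rest : (a * a + + 3) * (a * (+ 2 * b - a)) - (+ 2 * (a * a + + 3) + (a * b + + 1)) * (a * b - + 1) ≋ + 0 [ p ]
      rest = linear₂ (a * a + + 3) (- (+ 2 * (a * a + + 3) + (a * b + + 1))) e₂ e₁ (lemma₁ a b)
        where
        lemma₁ : ∀ a b →
          (a * a + + 3) * (a * (+ 2 * b - a)) - (+ 2 * (a * a + + 3) + (a * b + + 1)) * (a * b - + 1) - + 0 ≡
          (a * a + + 3) * (a * (+ 2 * b - a) - + 0) +
          - (+ 2 * (a * a + + 3) + (a * b + + 1)) * (a * b - + 1 - + 0)
        lemma₁ = solve-∀
      lemma₂ : ∀ a b → + 7 - + 0 ≡ a * a * (a * a + b * b - - + 1) + + 1 *
        ((a * a + + 3) * (a * (+ 2 * b - a)) - (+ 2 * (a * a + + 3) + (a * b + + 1)) * (a * b - + 1) - + 0)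
      lemma₂ = solve-∀

  antiperiodic⇒¬complete : ⊥
  antiperiodic⇒¬complete = p∤210 (ℕ.∣-trans
    (p∣7 a b
      (*-cancel-≋0 pr 6 (a * b - + 1) (λ d → p∤210 (ℕ.∣-trans d (ℕ.divides 35 refl))) 6[ab-1]≋0)
      (mod-trans (mod-reflexive (sym (F-2n h))) F2h)
      (mod-trans (mod-reflexive (sym (F-2n+1 h))) F2h+1))
    (ℕ.divides 30 refl))

-- One step back from (1, 1) stands (0, 1), so p - 1 is a period.
periodic⇒¬complete : ∀ {p} → Prime p → F p ≋ + 1 [ p ] → F (suc p) ≋ + 1 [ p ] → ¬ Complete F p
periodic⇒¬complete {0} pr _ _ _ = ℕ.≢-nonZero⁻¹ 0 {{prime⇒nonZero pr}} refl
periodic⇒¬complete {1} pr _ _ _ = ¬prime[1] pr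
periodic⇒¬complete {suc (suc n)} pr e₀ e₁ comp = ℕ.1+n≰n (complete⇒≤period
  (F⇒period (linear₂ (+ 1) (- + 1) e₁ e₀ (lemma (F (suc n)) (F (2 ℕ.+ n)))) e₀) (G-isGib (+ 0) (+ 1)) comp)
  where
  lemma : ∀ a b → a - + 0 ≡ + 1 * ((a + b) - + 1) + - + 1 * (b - + 1)
  lemma = solve-∀

prime⇒≡2⊎odd : ∀ {p} → Prime p → p ≡ 2 ⊎ ∃[ k ] p ≡ suc (suc k ℕ.+ suc k)
prime⇒≡2⊎odd {p} pr with p % 2 in r | p / 2 in q | ℕ.m≡m%n+[m/n]*n p 2 | ℕ.m%n<n p 2
... | 0 | _     | eq | _ with prime⇒irreducible pr (ℕ.m%n≡0⇒n∣m p 2 r)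
...   | inj₂ 2≡p = inj₁ (sym 2≡p)
prime⇒≡2⊎odd pr | 1 | zero  | refl | _ = ⊥-elim (¬prime[1] pr)
prime⇒≡2⊎odd pr | 1 | suc k | eq   | _ = inj₂ (k , trans eq (lemma k))
  where
  lemma : ∀ k → 1 ℕ.+ (1 ℕ.+ k) ℕ.* 2 ≡ 1 ℕ.+ ((1 ℕ.+ k) ℕ.+ (1 ℕ.+ k))
  lemma = ℕRing.solve-∀
prime⇒≡2⊎odd pr | suc (suc _) | _ | _ | s≤s (s≤s ())

F≋-1,0⇒¬complete : ∀ {p} → Prime p → ¬ p ℕ.∣ 210 → F p ≋ - + 1 [ p ] → F (suc p) ≋ + 0 [ p ] → ¬ Complete F p
F≋-1,0⇒¬complete pr p∤210 e₀ e₁ comp with prime⇒≡2⊎odd pr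
... | inj₁ refl       = p∤210 (ℕ.divides 105 refl)
... | inj₂ (k , refl) = antiperiodic⇒¬complete pr p∤210 e₀ e₁ comp

prime⇒¬complete : ∀ {p} → Prime p → ¬ p ℕ.∣ 210 → ¬ Complete F p
prime⇒¬complete pr p∤210 comp =
  [ (λ (e₀ , e₁) → periodic⇒¬complete pr e₀ e₁ comp) ,
    (λ (e₀ , e₁) → F≋-1,0⇒¬complete pr p∤210 e₀ e₁ comp) ]′ (F-at-prime pr p∤210)

-- Incomplete composite moduli

¬complete-compute : ∀ m π r .{{_ : ℕ.NonZero m}} .{{_ : ℕ.NonZero π}} → True (r ℕ.<? m) →
  walk m π (0 , 1) ≡ (0 , 1) → True (Fin.all? {π} λ i → ¬? (proj₁ (walk m (toℕ i) (0 , 1)) % m ℕ.≟ r)) →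
  ¬ Complete F m
¬complete-compute m π r r<m per check comp with comp (+ r)
... | n , e = toWitness check i (≋⇒≡ (ℕ.m%n<n t m) (toWitness r<m) (begin
  + (t % m)          ≈⟨ mod-%ℕ (+ t) m ⟨
  + t                ≈⟨ proj₁ (F-walk m (toℕ i)) ⟩
  F (toℕ i)          ≡⟨ cong F (Fin.toℕ-fromℕ< (ℕ.m%n<n n π)) ⟩
  F (n % π)          ≈⟨ period-% (F⇒period
                          (mod-trans (mod-sym (proj₁ (F-walk m π))) (mod-reflexive (cong (λ p → + proj₁ p) per)))
                          (mod-trans (mod-sym (proj₂ (F-walk m π))) (mod-reflexive (cong (λ p → + proj₂ p) per))))
                        (G-isGib (+ 0) (+ 1)) n ⟨
  F n                ≈⟨ e ⟩
  + r                ∎))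
  where
  open mod-Reasoning m
  i : Fin π
  i = fromℕ< (ℕ.m%n<n n π)
  t = proj₁ (walk m (toℕ i) (0 , 1))

-- The six moduli from here on are minimal under divisibility among the integers above 1 composed of
-- 2, 3, 5, 7 and outside `FibonacciModuli`. The arguments give a period and a missed residue.
¬complete-8 : ¬ Complete F 8
¬complete-8 = ¬complete-compute 8 12 4 _ refl _

¬complete-12 : ¬ Complete F 12
¬complete-12 = ¬complete-compute 12 24 6 _ refl _

¬complete-18 : ¬ Complete F 18
¬complete-18 = ¬complete-compute 18 24 4 _ refl _

¬complete-21 : ¬ Complete F 21
¬complete-21 = ¬complete-compute 21 16 4 _ refl _

¬complete-28 : ¬ Complete F 28
¬complete-28 = ¬complete-compute 28 48 10 _ refl _

¬complete-49 : ¬ Complete F 49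
¬complete-49 = ¬complete-compute 49 112 4 _ refl _

complete-∣ : ∀ {d} → d ℕ.∣ m → Complete s m → Complete s d
complete-∣ d∣m comp r = let n , e = comp r in n , mod-∣ d∣m e

-- Classification of the complete moduli

prime∣prime⇒≡ : ∀ {p q} → Prime p → Prime q → p ℕ.∣ q → p ≡ q
prime∣prime⇒≡ p-pr q-pr p∣q with prime⇒irreducible q-pr p∣q
... | inj₁ refl = ⊥-elim (¬prime[1] p-pr)
... | inj₂ eq   = eq

prime∣210⇒∈ : ∀ {p} → Prime p → p ℕ.∣ 210 → p ∈ 2 ∷ 3 ∷ 5 ∷ 7 ∷ []
prime∣210⇒∈ pr p∣210 with euclidsLemma 6 35 pr p∣210
... | inj₁ p∣6 = [ (λ d → here (prime∣prime⇒≡ pr prime[2] d)) ,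
                   (λ d → there (here (prime∣prime⇒≡ pr (from-yes (prime? 3)) d))) ]′ (euclidsLemma 2 3 pr p∣6)
... | inj₂ p∣35 = [ (λ d → there (there (here (prime∣prime⇒≡ pr (from-yes (prime? 5)) d)))) ,
                    (λ d → there (there (there (here (prime∣prime⇒≡ pr (from-yes (prime? 7)) d))))) ]′ (euclidsLemma 5 7 pr p∣35)

smooth : ∀ {ps} → All (_∈ 2 ∷ 3 ∷ 5 ∷ 7 ∷ []) ps →
         ∃[ a ] ∃[ b ] ∃[ c ] ∃[ d ] product ps ≡ 2 ^ a ℕ.* 3 ^ b ℕ.* 5 ^ c ℕ.* 7 ^ d
smooth [] = 0 , 0 , 0 , 0 , refl
smooth {p ∷ ps} (p∈ ∷ ps∈) with smooth ps∈
... | a , b , c , d , eq = extend p∈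
  where
  Factored : ℕ → Set
  Factored n = ∃[ a ] ∃[ b ] ∃[ c ] ∃[ d ] n ≡ 2 ^ a ℕ.* 3 ^ b ℕ.* 5 ^ c ℕ.* 7 ^ d
  extend : p ∈ 2 ∷ 3 ∷ 5 ∷ 7 ∷ [] → Factored (p ℕ.* product ps)
  extend (here refl) = suc a , b , c , d , trans (cong (2 ℕ.*_) eq) (lemma (2 ^ a) (3 ^ b) (5 ^ c) (7 ^ d))
    where
    lemma : ∀ A B C D → 2 ℕ.* (A ℕ.* B ℕ.* C ℕ.* D) ≡ 2 ℕ.* A ℕ.* B ℕ.* C ℕ.* D
    lemma = ℕRing.solve-∀
  extend (there (here refl)) = a , suc b , c , d , trans (cong (3 ℕ.*_) eq) (lemma (2 ^ a) (3 ^ b) (5 ^ c) (7 ^ d))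
    where
    lemma : ∀ A B C D → 3 ℕ.* (A ℕ.* B ℕ.* C ℕ.* D) ≡ A ℕ.* (3 ℕ.* B) ℕ.* C ℕ.* D
    lemma = ℕRing.solve-∀
  extend (there (there (here refl))) = a , b , suc c , d , trans (cong (5 ℕ.*_) eq) (lemma (2 ^ a) (3 ^ b) (5 ^ c) (7 ^ d))
    where
    lemma : ∀ A B C D → 5 ℕ.* (A ℕ.* B ℕ.* C ℕ.* D) ≡ A ℕ.* B ℕ.* (5 ℕ.* C) ℕ.* D
    lemma = ℕRing.solve-∀
  extend (there (there (there (here refl)))) = a , b , c , suc d , trans (cong (7 ℕ.*_) eq) (lemma (2 ^ a) (3 ^ b) (5 ^ c) (7 ^ d))
    where
    lemma : ∀ A B C D → 7 ℕ.* (A ℕ.* B ℕ.* C ℕ.* D) ≡ A ℕ.* B ℕ.* C ℕ.* (7 ℕ.* D)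
    lemma = ℕRing.solve-∀

F-complete⇒smooth : .{{_ : ℕ.NonZero m}} → Complete F m →
                    ∃[ a ] ∃[ b ] ∃[ c ] ∃[ d ] m ≡ 2 ^ a ℕ.* 3 ^ b ℕ.* 5 ^ c ℕ.* 7 ^ d
F-complete⇒smooth {m} comp = let a , b , c , d , eq = smooth small in a , b , c , d , trans isFactorisation eq
  where
  open PrimeFactorisation (factorise m)
  small : All (_∈ 2 ∷ 3 ∷ 5 ∷ 7 ∷ []) factors
  small = All.tabulate λ {p} p∈ → let pr = All.lookup factorsPrime p∈ in prime∣210⇒∈ pr (decidable-stable (p ℕ.∣? 210)
    λ p∤210 → prime⇒¬complete pr p∤210 (complete-∣ (subst (p ℕ.∣_) (sym isFactorisation) (∈⇒∣product p∈)) comp))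

-- Every pattern of exponents either contains one of the six incomplete moduli or is a listed
-- family; the exponent of 5 stays free.
smooth∧F-complete⇒fibonacciModuli : ∀ a b c d → let m = 2 ^ a ℕ.* 3 ^ b ℕ.* 5 ^ c ℕ.* 7 ^ d in
  1 ≢ m → Complete F m → FibonacciModuli m
smooth∧F-complete⇒fibonacciModuli (suc (suc (suc a))) b c d ≢1 comp =
  ⊥-elim (¬complete-8 (complete-∣ (ℕ.divides (2 ^ a ℕ.* 3 ^ b ℕ.* 5 ^ c ℕ.* 7 ^ d) (lemma (2 ^ a) (3 ^ b) (5 ^ c) (7 ^ d))) comp))
  where
  lemma : ∀ A B C D → 2 ℕ.* (2 ℕ.* (2 ℕ.* A)) ℕ.* B ℕ.* C ℕ.* D ≡ A ℕ.* B ℕ.* C ℕ.* D ℕ.* 8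
  lemma = ℕRing.solve-∀
smooth∧F-complete⇒fibonacciModuli (suc (suc zero)) (suc b) c d ≢1 comp =
  ⊥-elim (¬complete-12 (complete-∣ (ℕ.divides (3 ^ b ℕ.* 5 ^ c ℕ.* 7 ^ d) (lemma (3 ^ b) (5 ^ c) (7 ^ d))) comp))
  where
  lemma : ∀ B C D → 4 ℕ.* (3 ℕ.* B) ℕ.* C ℕ.* D ≡ B ℕ.* C ℕ.* D ℕ.* 12
  lemma = ℕRing.solve-∀
smooth∧F-complete⇒fibonacciModuli (suc (suc zero)) zero c (suc d) ≢1 comp =
  ⊥-elim (¬complete-28 (complete-∣ (ℕ.divides (5 ^ c ℕ.* 7 ^ d) (lemma (5 ^ c) (7 ^ d))) comp))
  where
  lemma : ∀ C D → 4 ℕ.* C ℕ.* (7 ℕ.* D) ≡ C ℕ.* D ℕ.* 28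
  lemma = ℕRing.solve-∀
smooth∧F-complete⇒fibonacciModuli (suc (suc zero)) zero c zero ≢1 comp =
  -- 1 is a default value for j, which parametrises the powers of 3 in `family`.
  (c , 1 , s≤s z≤n , there (there (here (ℕ.*-identityʳ _)))) , ≢1
smooth∧F-complete⇒fibonacciModuli (suc zero) (suc (suc b)) c d ≢1 comp =
  ⊥-elim (¬complete-18 (complete-∣ (ℕ.divides (3 ^ b ℕ.* 5 ^ c ℕ.* 7 ^ d) (lemma (3 ^ b) (5 ^ c) (7 ^ d))) comp))
  where
  lemma : ∀ B C D → 2 ℕ.* (3 ℕ.* (3 ℕ.* B)) ℕ.* C ℕ.* D ≡ B ℕ.* C ℕ.* D ℕ.* 18
  lemma = ℕRing.solve-∀
smooth∧F-complete⇒fibonacciModuli (suc zero) (suc zero) c zero ≢1 comp =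
  (c , 1 , s≤s z≤n , there (there (there (there (here (ℕ.*-identityʳ _)))))) , ≢1
smooth∧F-complete⇒fibonacciModuli (suc zero) zero c zero ≢1 comp =
  (c , 1 , s≤s z≤n , there (here (ℕ.*-identityʳ _))) , ≢1
smooth∧F-complete⇒fibonacciModuli (suc zero) zero c (suc zero) ≢1 comp =
  (c , 1 , s≤s z≤n , there (there (there (there (there (there (here (lemma (5 ^ c))))))))) , ≢1
  where
  lemma : ∀ C → 2 ℕ.* C ℕ.* 7 ≡ 14 ℕ.* C
  lemma = ℕRing.solve-∀
smooth∧F-complete⇒fibonacciModuli a (suc b) c (suc d) ≢1 comp =
  ⊥-elim (¬complete-21 (complete-∣ (ℕ.divides (2 ^ a ℕ.* 3 ^ b ℕ.* 5 ^ c ℕ.* 7 ^ d) (lemma (2 ^ a) (3 ^ b) (5 ^ c) (7 ^ d))) comp))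
  where
  lemma : ∀ A B C D → A ℕ.* (3 ℕ.* B) ℕ.* C ℕ.* (7 ℕ.* D) ≡ A ℕ.* B ℕ.* C ℕ.* D ℕ.* 21
  lemma = ℕRing.solve-∀
smooth∧F-complete⇒fibonacciModuli zero (suc b) c zero ≢1 comp =
  (c , suc b , s≤s z≤n , there (there (there (here (lemma (3 ^ suc b) (5 ^ c)))))) , ≢1
  where
  lemma : ∀ B C → 1 ℕ.* B ℕ.* C ℕ.* 1 ≡ B ℕ.* C
  lemma = ℕRing.solve-∀
smooth∧F-complete⇒fibonacciModuli a zero c (suc (suc d)) ≢1 comp =
  ⊥-elim (¬complete-49 (complete-∣ (ℕ.divides (2 ^ a ℕ.* 5 ^ c ℕ.* 7 ^ d) (lemma (2 ^ a) (5 ^ c) (7 ^ d))) comp))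
  where
  lemma : ∀ A C D → A ℕ.* 1 ℕ.* C ℕ.* (7 ℕ.* (7 ℕ.* D)) ≡ A ℕ.* C ℕ.* D ℕ.* 49
  lemma = ℕRing.solve-∀
smooth∧F-complete⇒fibonacciModuli zero zero c (suc zero) ≢1 comp =
  (c , 1 , s≤s z≤n , there (there (there (there (there (here (lemma (5 ^ c)))))))) , ≢1
  where
  lemma : ∀ C → 1 ℕ.* C ℕ.* 7 ≡ 7 ℕ.* C
  lemma = ℕRing.solve-∀
smooth∧F-complete⇒fibonacciModuli zero zero c zero ≢1 comp =
  (c , 1 , s≤s z≤n , here (lemma (5 ^ c))) , ≢1
  where
  lemma : ∀ C → 1 ℕ.* C ℕ.* 1 ≡ C
  lemma = ℕRing.solve-∀

F-complete⇒fibonacciModuli : 2 ≤ m → Complete F m → FibonacciModuli m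
F-complete⇒fibonacciModuli 2≤m comp =
  let a , b , c , d , eq = F-complete⇒smooth {{ℕ.>-nonZero (ℕ.<⇒≤ 2≤m)}} comp in
  subst FibonacciModuli (sym eq) (smooth∧F-complete⇒fibonacciModuli a b c d
    (λ 1≡m → ℕ.<⇒≢ 2≤m (trans 1≡m (sym eq))) (subst (Complete F) eq comp))

-- Bézout coefficients and the two sets of moduli

gcd≡1⇒primitive : ∀ a b → gcd a b ≡ + 1 → Primitive a b
gcd≡1⇒primitive a b eq with abs-unit a | abs-unit b
  where
  -- Bézout's identity is applied to absolute values; the signs ε = ±1 are then moved into the
  -- coefficients.
  abs-unit : ∀ a → ∃[ ε ] + ∣ a ∣ ≡ ε * a
  abs-unit (+ n)    = + 1 , sym (ℤ.*-identityˡ (+ n))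
  abs-unit -[1+ n ] = - + 1 , sym (ℤ.-1*i≡-i -[1+ n ])
... | α , α-eq | β , β-eq
  with Bézout.identity (subst (GCD ∣ a ∣ ∣ b ∣) (ℤ.+-injective eq) (gcd-GCD ∣ a ∣ ∣ b ∣))
... | Bézout.+- x y eq′ = + x * α , - (+ y * β) , (begin
  + x * α * a + - (+ y * β) * b      ≡⟨ lemma₁ (+ x) α a (+ y) β b ⟩
  + x * (α * a) - + y * (β * b)      ≡⟨ cong₂ (λ t u → + x * t - + y * u) α-eq β-eq ⟨
  + x * + ∣ a ∣ - + y * + ∣ b ∣      ≡⟨ cong₂ _-_ (ℤ.pos-* x ∣ a ∣) (ℤ.pos-* y ∣ b ∣) ⟨
  + (x ℕ.* ∣ a ∣) - + (y ℕ.* ∣ b ∣)  ≡⟨ cong (λ t → + t - + (y ℕ.* ∣ b ∣)) eq′ ⟨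
  (+ 1 + + (y ℕ.* ∣ b ∣)) - + (y ℕ.* ∣ b ∣)  ≡⟨ lemma₂ (+ (y ℕ.* ∣ b ∣)) ⟩
  + 1                                ∎)
  where
  open ≡-Reasoning
  lemma₁ : ∀ x α a y β b → x * α * a + - (y * β) * b ≡ x * (α * a) - y * (β * b)
  lemma₁ = solve-∀
  lemma₂ : ∀ t → (+ 1 + t) - t ≡ + 1
  lemma₂ = solve-∀
... | Bézout.-+ x y eq′ = - (+ x * α) , + y * β , (begin
  - (+ x * α) * a + + y * β * b      ≡⟨ lemma₁ (+ x) α a (+ y) β b ⟩
  + y * (β * b) - + x * (α * a)      ≡⟨ cong₂ (λ t u → + y * u - + x * t) α-eq β-eq ⟨
  + y * + ∣ b ∣ - + x * + ∣ a ∣      ≡⟨ cong₂ _-_ (ℤ.pos-* y ∣ b ∣) (ℤ.pos-* x ∣ a ∣) ⟨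
  + (y ℕ.* ∣ b ∣) - + (x ℕ.* ∣ a ∣)  ≡⟨ cong (λ t → + t - + (x ℕ.* ∣ a ∣)) eq′ ⟨
  (+ 1 + + (x ℕ.* ∣ a ∣)) - + (x ℕ.* ∣ a ∣)  ≡⟨ lemma₂ (+ (x ℕ.* ∣ a ∣)) ⟩
  + 1                                ∎)
  where
  open ≡-Reasoning
  lemma₁ : ∀ x α a y β b → - (x * α) * a + y * β * b ≡ y * (β * b) - x * (α * a)
  lemma₁ = solve-∀
  lemma₂ : ∀ t → (+ 1 + t) - t ≡ + 1
  lemma₂ = solve-∀

Δ≋0 : IsGib s → Δ (s 0) (s 1) ≋ + 0 [ m ] → ∀ n → Δ (s n) (s (suc n)) ≋ + 0 [ m ]
Δ≋0 gs e zero    = e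
Δ≋0 {s} gs e (suc n) = mod-trans (mod-reflexive (Δ-step gs n)) (mod-neg (Δ≋0 gs e n))

5∤1 : ¬ 5 ℕ.∣ 1
5∤1 = ℕ.>⇒∤ (s≤s (s≤s z≤n))

-- At a zero modulo 5 the form Δ reduces to -b² with b a unit, so it cannot vanish modulo 5.
Δ≋0⇒5∤ : IsGib s → Primitive (s 0) (s 1) → Δ (s 0) (s 1) ≋ + 0 [ 5 ] → Complete s m → ¬ 5 ℕ.∣ m
Δ≋0⇒5∤ {s} gs prim Δ≋ comp 5∣m with comp (+ 0)
... | n , e₀ with zero-inverse gs prim n (mod-∣ 5∣m e₀)
... | v , ve = 5∤1 (≋0⇒ℕ∣ 1 (begin
  + 1                                        ≈⟨ mod-* ve ve ⟨
  v * b * (v * b)                            ≡⟨ lemma v (s n) b ⟩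
  v * v * ((s n) * (s n + b) - Δ (s n) b)    ≈⟨ mod-*ˡ (v * v) (mod-- (mod-*ʳ (s n + b) (mod-∣ 5∣m e₀)) (Δ≋0 gs Δ≋ n)) ⟩
  v * v * (+ 0 * (s n + b) - + 0)            ≡⟨ lemma′ v (s n + b) ⟩
  + 0                                        ∎))
  where
  open mod-Reasoning 5
  b = s (suc n)
  lemma : ∀ v a b → v * b * (v * b) ≡ v * v * (a * (a + b) - (a * a + a * b - b * b))
  lemma = solve-∀
  lemma′ : ∀ v t → v * v * (+ 0 * t - + 0) ≡ + 0
  lemma′ = solve-∀

5∣*5^ : ∀ n k → 5 ℕ.∣ n ℕ.* 5 ^ suc k
5∣*5^ n k = ℕ.∣n⇒∣m*n n (ℕ.m∣m*n (5 ^ k))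

fibonacciModuli∧5∤⇒lucasModuli : FibonacciModuli m → ¬ 5 ℕ.∣ m → LucasModuli m
fibonacciModuli∧5∤⇒lucasModuli ((zero , j , 1≤j , mem) , ≢1) 5∤m with mem
... | here refl                                                 = ⊥-elim (≢1 refl)
... | there (here refl)                                         = inj₁ (here refl)
... | there (there (here refl))                                 = inj₁ (there (here refl))
... | there (there (there (here refl)))                         = inj₂ (j , 1≤j , ℕ.*-identityʳ (3 ^ j))
... | there (there (there (there (here refl))))                 = inj₁ (there (there (here refl)))
... | there (there (there (there (there (here refl)))))         = inj₁ (there (there (there (here refl))))
... | there (there (there (there (there (there (here refl)))))) = inj₁ (there (there (there (there (here refl)))))
fibonacciModuli∧5∤⇒lucasModuli ((suc k , j , _ , mem) , _) 5∤m with mem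
... | here refl                                                 = ⊥-elim (5∤m (ℕ.m∣m*n (5 ^ k)))
... | there (here refl)                                         = ⊥-elim (5∤m (5∣*5^ 2 k))
... | there (there (here refl))                                 = ⊥-elim (5∤m (5∣*5^ 4 k))
... | there (there (there (here refl)))                         = ⊥-elim (5∤m (5∣*5^ (3 ^ j) k))
... | there (there (there (there (here refl))))                 = ⊥-elim (5∤m (5∣*5^ 6 k))
... | there (there (there (there (there (here refl)))))         = ⊥-elim (5∤m (5∣*5^ 7 k))
... | there (there (there (there (there (there (here refl)))))) = ⊥-elim (5∤m (5∣*5^ 14 k))

2≤*5^ : ∀ {n} → 2 ≤ n → ∀ k → 2 ≤ n ℕ.* 5 ^ k
2≤*5^ {n} 2≤n k = ℕ.≤-trans 2≤n (ℕ.m≤m*n n (5 ^ k) {{ℕ.m^n≢0 5 k}})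

2≤3^ : ∀ j → 2 ≤ 3 ^ suc j
2≤3^ j = ℕ.≤-trans (ℕ.m≤m+n 2 1) (ℕ.m≤m*n 3 (3 ^ j) {{ℕ.m^n≢0 3 j}})

fibonacciModuli⇒2≤ : FibonacciModuli m → 2 ≤ m
fibonacciModuli⇒2≤ ((zero  , _ , _ , here refl) , ≢1) = ⊥-elim (≢1 refl)
fibonacciModuli⇒2≤ ((suc k , _ , _ , here refl) , _) = 2≤*5^ (ℕ.m≤m+n 2 3) k
fibonacciModuli⇒2≤ ((k , _ , _ , there (here refl)) , _) = 2≤*5^ (ℕ.m≤m+n 2 0) k
fibonacciModuli⇒2≤ ((k , _ , _ , there (there (here refl))) , _) = 2≤*5^ (ℕ.m≤m+n 2 2) k
fibonacciModuli⇒2≤ ((k , suc j , _ , there (there (there (here refl)))) , _) = 2≤*5^ (2≤3^ j) k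
fibonacciModuli⇒2≤ ((k , _ , _ , there (there (there (there (here refl))))) , _) = 2≤*5^ (ℕ.m≤m+n 2 4) k
fibonacciModuli⇒2≤ ((k , _ , _ , there (there (there (there (there (here refl)))))) , _) = 2≤*5^ (ℕ.m≤m+n 2 5) k
fibonacciModuli⇒2≤ ((k , _ , _ , there (there (there (there (there (there (here refl))))))) , _) = 2≤*5^ (ℕ.m≤m+n 2 12) k

lucasModuli⇒2≤ : LucasModuli m → 2 ≤ m
lucasModuli⇒2≤ (inj₁ (here refl)) = ℕ.m≤m+n 2 _
lucasModuli⇒2≤ (inj₁ (there (here refl))) = ℕ.m≤m+n 2 _
lucasModuli⇒2≤ (inj₁ (there (there (here refl)))) = ℕ.m≤m+n 2 _
lucasModuli⇒2≤ (inj₁ (there (there (there (here refl))))) = ℕ.m≤m+n 2 _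
lucasModuli⇒2≤ (inj₁ (there (there (there (there (here refl)))))) = ℕ.m≤m+n 2 _
lucasModuli⇒2≤ (inj₂ (suc j , _ , refl)) = 2≤3^ j

module _ {a b : ℤ} (prim : Primitive a b) where

  -- Completeness transfers to F for every primitive pair, so this inclusion serves both cases of
  -- the theorem.
  M⇒fibonacciModuli : M a b m → FibonacciModuli m
  M⇒fibonacciModuli {m} (2≤m , comp) = F-complete⇒fibonacciModuli 2≤m
    (complete⇒F-complete m {{ℕ.>-nonZero (ℕ.<⇒≤ 2≤m)}} (G-isGib a b) prim λ r → let n , d = comp r in n , mod d)

  M-lucas : Δ a b ≋ + 0 [ 5 ] → M a b ≐ LucasModuli
  M-lucas Δ≋ =
    (λ Mm@(_ , comp) → fibonacciModuli∧5∤⇒lucasModuli (M⇒fibonacciModuli Mm)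
      (Δ≋0⇒5∤ (G-isGib a b) prim Δ≋ λ r → let n , d = comp r in n , mod d)) ,
    (λ Lm → lucasModuli⇒2≤ Lm , λ r →
      let n , e = lucasModuli⇒complete (G-isGib a b) prim Lm r in n , ∣-diff e)

  M-fibonacci : ¬ Δ a b ≋ + 0 [ 5 ] → M a b ≐ FibonacciModuli
  M-fibonacci Δ≢ =
    M⇒fibonacciModuli ,
    (λ Fm → fibonacciModuli⇒2≤ Fm , λ r →
      let n , e = fibonacciModuli⇒complete (G-isGib a b) prim Δ≢ Fm r in n , ∣-diff e)

mainTheorem16 : ∀ (a b : ℤ) → gcd a b ≡ + 1 →
    (a * a + a * b - b * b ≡ + 0 [mod 5 ] → (M a b ≐ M-L) × (M-L ≐ LucasModuli)) ×
    (¬ (a * a + a * b - b * b ≡ + 0 [mod 5 ]) → (M a b ≐ M-F) × (M-F ≐ FibonacciModuli))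
mainTheorem16 a b gcd≡1 =
  (λ Δ≡0 → ≐-trans (M-lucas prim (mod Δ≡0)) (≐-sym lucas) , lucas) ,
  (λ Δ≢0 → ≐-trans (M-fibonacci prim (λ e → Δ≢0 (∣-diff e))) (≐-sym fibonacci) , fibonacci)
  where
  prim = gcd≡1⇒primitive a b gcd≡1
  lucas : M-L ≐ LucasModuli
  -- Δ at (1, 3) is 1 + 3 - 9 = -5.
  lucas = M-lucas (+ 1 , + 0 , refl) (mod (divides (- + 1) refl))
  fibonacci : M-F ≐ FibonacciModuli
  -- Δ at (1, 1) is 1.
  fibonacci = M-fibonacci (+ 1 , + 0 , refl) λ e → 5∤1 (≋0⇒ℕ∣ 1 e)
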